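{- For $n\ge1$ define the polynomials in $Y,A,B$ $$e_n=\sum_{\substack{\alpha,\beta\in NC(n)\\ \alpha\wedge\beta=0_n,\ \alpha\vee\beta=1_n}} Y^{\|\alpha^{ -1}\beta\|}A^{\|\alpha\|}B^{\|\beta\|},\qquad f_n=\sum_{\substack{\alpha,\beta\in NC(n)\\ \alpha\vee\beta=1_n}} Y^{\|\alpha^{ -1}\beta\|}A^{n-1-\|\alpha\|}B^{n-1-\|\beta\|},$$ $$g_n=\sum_{\alpha,\beta\in NC(n)} Y^{\|\alpha^{ -1}\beta\|}A^{\|\alpha^{ -1}(\alpha\vee\beta)\|}B^{\|\beta^{ -1}(\alpha\vee\beta)\|}.$$ Then $\mathcal F$ maps $(e_n)_{n\ge1}$ to $(f_n)_{n\ge1}$ and maps $(f_n)_{n\ge1}$ to $(g_n)_{n\ge1}$; that is, for all $n\ge1$, $$f_n=\sum_{\sigma\in NC(n)}\prod_{c\in\sigma} e_{|c|},\qquad g_n=\sum_{\sigma\in NC(n)}\prod_{c\in\sigma} f_{|c|},$$ where the products run over the blocks $c$ of $\sigma$ and $|c|$ is the size of $c$.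
   Context: $\|\sigma\|$ denotes the length of a permutation $\sigma\in S_n$ (minimal number of transpositions with product $\sigma$; equals $n$ minus the number of cycles). $NC(n)$ is the lattice of non-crossing partitions of $\{1,\dots,n\}$ under reverse refinement, with meet $\wedge$, join $\vee$, minimum $0_n$ (all singletons) and maximum $1_n$ (single block). Each $\alpha\in NC(n)$ is identified with the permutation whose cycles are its blocks, each block $\{x_1<\dots<x_k\}$ becoming the cycle $x_1\mapsto x_2\mapsto\dots\mapsto x_k\mapsto x_1$; products like $\alpha^{ -1}\beta$ are taken in $S_n$. The transformation $\mathcal F$ sends a sequence $(\kappa_n)_{n\ge1}$ (in a commutative ring) to the sequence $(m_n)_{n\ge1}$ given by the moment-cumulant formula $m_n=\sum_{\sigma\in NC(n)}\prod_{c\in\sigma}\kappa_{|c|}$. -}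

module Defs where

open import Data.Nat as ℕ using (ℕ; zero; suc; _∸_)
open import Data.Fin as Fin using (Fin; toℕ)
open import Data.Fin.Properties using (_≟_)
open import Data.Bool using (Bool; true; false; _∧_; _∨_; not; if_then_else_)
open import Data.List using (List; []; _∷_; [_]; map; concatMap; filterᵇ; foldr; length; upTo; allFin)
open import Data.Bool.ListAction using (all; any)
open import Data.Vec as Vec using (Vec)
open import Relation.Nullary.Decidable using (⌊_⌋)
open import Algebra.Bundles using (CommutativeRing)

allF : ∀ {n} → (Fin n → Bool) → Bool
allF {n} P = all P (allFin n)

anyF : ∀ {n} → (Fin n → Bool) → Bool
anyF {n} P = any P (allFin n)

_==_ : ∀ {n} → Fin n → Fin n → Bool
i == j = ⌊ i ≟ j ⌋

_<ᶠ_ : ∀ {n} → Fin n → Fin n → Bool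
i <ᶠ j = toℕ i ℕ.<ᵇ toℕ j

_≤ᶠ_ : ∀ {n} → Fin n → Fin n → Bool
i ≤ᶠ j = toℕ i ℕ.≤ᵇ toℕ j

firstSat : ∀ {n} → (Fin n → Bool) → Fin n → List (Fin n) → Fin n
firstSat P d [] = d
firstSat P d (x ∷ xs) = if P x then x else firstSat P d xs

minSat : ∀ {n} → (Fin n → Bool) → Fin n → Fin n
minSat {n} P d = firstSat P d (allFin n)

countF : ∀ {n} → (Fin n → Bool) → ℕ
countF {n} P = length (filterᵇ P (allFin n))

vecs : ∀ {a} {A : Set a} (k : ℕ) → List A → List (Vec A k)
vecs zero xs = [ Vec.[] ]
vecs (suc k) xs = concatMap (λ x → map (x Vec.∷_) (vecs k xs)) xs

-- Set partitions of {0,…,n-1}, encoded canonically by the map sending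
-- each element to the minimum of its block.

Partition : ℕ → Set
Partition n = Fin n → Fin n

same : ∀ {n} → Partition n → Fin n → Fin n → Bool
same p i j = p i == p j

isCanonical : ∀ {n} → Partition n → Bool
isCanonical p = allF λ i → (p (p i) == p i) ∧ (p i ≤ᶠ i)

isNonCrossing : ∀ {n} → Partition n → Bool
isNonCrossing p = not (anyF λ a → anyF λ b → anyF λ c → anyF λ d →
  (a <ᶠ b) ∧ (b <ᶠ c) ∧ (c <ᶠ d) ∧ same p a c ∧ same p b d ∧ not (same p a b))

-- NC(n): every non-crossing partition of {0,…,n-1}, each listed exactly once
NC : (n : ℕ) → List (Partition n)
NC n = filterᵇ (λ p → isCanonical p ∧ isNonCrossing p)
               (map Vec.lookup (vecs n (allFin n)))

_≐_ : ∀ {n} → Partition n → Partition n → Bool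
p ≐ q = allF λ i → p i == q i

_≼_ : ∀ {n} → Partition n → Partition n → Bool
α ≼ γ = allF λ i → allF λ j → not (same α i j) ∨ same γ i j

bot : ∀ {n} → Partition n
bot i = i

top : ∀ {n} → Partition n
top i = minSat (λ _ → true) i

_∧ₙ_ : ∀ {n} → Partition n → Partition n → Partition n
(α ∧ₙ β) i = minSat (λ j → same α i j ∧ same β i j) i

_∨ₙ_ : ∀ {n} → Partition n → Partition n → Partition n
_∨ₙ_ {n} α β = foldr _∧ₙ_ top (filterᵇ (λ γ → (α ≼ γ) ∧ (β ≼ γ)) (NC n))

blockMins : ∀ {n} → Partition n → List (Fin n)
blockMins {n} p = filterᵇ (λ i → p i == i) (allFin n)

blockSize : ∀ {n} → Partition n → Fin n → ℕ
blockSize p r = countF (λ j → p j == r)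

Perm : ℕ → Set
Perm n = Fin n → Fin n

-- the permutation with one cycle x₁ ↦ x₂ ↦ … ↦ x_k ↦ x₁ per block {x₁<…<x_k}
perm : ∀ {n} → Partition n → Perm n
perm p i = minSat (λ j → same p i j ∧ (i <ᶠ j)) (p i)

inv : ∀ {n} → Perm n → Perm n
inv σ i = minSat (λ j → σ j == i) i

_·_ : ∀ {n} → Perm n → Perm n → Perm n
(σ · τ) i = σ (τ i)

iter : ∀ {n} → Perm n → ℕ → Fin n → Fin n
iter σ zero i = i
iter σ (suc k) i = σ (iter σ k i)

-- number of cycles: number of i that are the minimum of their cycle
cycles : ∀ {n} → Perm n → ℕ
cycles {n} σ = countF (λ i → all (λ k → i ≤ᶠ iter σ k i) (upTo n))

∥_∥ : ∀ {n} → Perm n → ℕ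
∥_∥ {n} σ = n ∸ cycles σ

∥_∥ₚ : ∀ {n} → Partition n → ℕ
∥ α ∥ₚ = ∥ perm α ∥

dist : ∀ {n} → Partition n → Partition n → ℕ
dist α β = ∥ inv (perm α) · perm β ∥

module Poly {c ℓ} (R : CommutativeRing c ℓ) where
  open CommutativeRing R

  pow : Carrier → ℕ → Carrier
  pow x zero = 1#
  pow x (suc k) = x * pow x k

  Σ : ∀ {a} {A : Set a} → List A → (A → Carrier) → Carrier
  Σ xs h = foldr (λ x s → h x + s) 0# xs

  Π : ∀ {a} {A : Set a} → List A → (A → Carrier) → Carrier
  Π xs h = foldr (λ x s → h x * s) 1# xs

  𝓕 : (ℕ → Carrier) → ℕ → Carrier
  𝓕 κ n = Σ (NC n) λ σ → Π (blockMins σ) λ r → κ (blockSize σ r)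

  Σ₂ : (n : ℕ) → (Partition n → Partition n → Carrier) → Carrier
  Σ₂ n h = Σ (NC n) λ α → Σ (NC n) λ β → h α β

  when : Bool → Carrier → Carrier
  when true x = x
  when false _ = 0#

  module _ (Y A B : Carrier) where

    eₙ : ℕ → Carrier
    eₙ n = Σ₂ n λ α β → when (((α ∧ₙ β) ≐ bot) ∧ ((α ∨ₙ β) ≐ top))
             (pow Y (dist α β) * pow A ∥ α ∥ₚ * pow B ∥ β ∥ₚ)

    fₙ : ℕ → Carrier
    fₙ n = Σ₂ n λ α β → when ((α ∨ₙ β) ≐ top)
             (pow Y (dist α β) * pow A (n ∸ 1 ∸ ∥ α ∥ₚ) * pow B (n ∸ 1 ∸ ∥ β ∥ₚ))

    gₙ : ℕ → Carrier
    gₙ n = Σ₂ n λ α β →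
             pow Y (dist α β) * pow A (dist α (α ∨ₙ β)) * pow B (dist β (α ∨ₙ β))

-- A weight W(α,β,σ) that factors over the blocks of σ satisfies Σ W(α,β,α∨β) = Σ_σ Π_c κ_{|c|}, where κ_k is
-- the sum of W(α,β,1_k) over the pairs with α ∨ β = 1_k: a pair with join σ is an independent choice, for each
-- block of σ, of a pair with maximal join, and these blocks are split off one at a time. The summand of g is
-- such a weight, with κ = f because ‖α⁻¹1_n‖ = n - 1 - ‖α‖. For f, the Kreweras complement K, for which
-- α · K α is the long cycle, preserves ‖α⁻¹β‖, sends ‖α‖ to n - 1 - ‖α‖ and turns α ∨ β = 1 into
-- K α ∧ K β = 0; hence f_n is the sum of Y^‖α⁻¹β‖ A^‖α‖ B^‖β‖ over the pairs with α ∧ β = 0. That weight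
-- factors too, and its κ is e.
module Submission where

open import Defs
open import Algebra.Bundles using (CommutativeRing; CommutativeMonoid)
open import Data.Bool using (Bool; true; false; _∧_; _∨_; not; if_then_else_; T)
open import Data.Bool.ListAction using (all; any; and)
import Data.Bool.Properties as Boolₚ
open import Data.Empty using (⊥)
open import Data.Fin as Fin using (Fin; zero; suc; toℕ)
import Data.Fin.Properties as Finₚ
open import Data.List as List using (List; []; _∷_; _++_; map; concatMap; filterᵇ; foldr; length; upTo; allFin)
import Data.List.Properties as Listₚ
open import Data.List.Membership.Propositional using (_∈_)
import Data.List.Membership.Propositional.Properties as ∈ₚ
open import Data.List.Relation.Unary.All as All using (All; []; _∷_)
open import Data.List.Relation.Unary.AllPairs as AllPairs using (AllPairs; []; _∷_)
import Data.List.Relation.Unary.AllPairs.Properties as AllPairsₚ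
open import Data.List.Relation.Unary.Any as Any using (here; there)
import Data.List.Relation.Unary.Any.Properties as Anyₚ
open import Data.Nat as ℕ using (ℕ; zero; suc; _+_; _∸_; s≤s; _≤_)
import Data.Nat.Induction as ℕᵢ
import Data.Nat.Properties as ℕₚ
open import Data.Product using (_×_; _,_; proj₁; proj₂; ∃-syntax)
open import Data.Sum using (_⊎_; inj₁; inj₂)
open import Data.Unit using (⊤; tt)
open import Data.Vec as Vec using (Vec)
import Data.Vec.Properties as Vecₚ
open import Function using (_∘_; id)
open import Level using (Level; _⊔_)
open import Relation.Binary using (tri<; tri≈; tri>)
open import Relation.Binary.PropositionalEquality
  using (_≡_; _≢_; _≗_; refl; sym; trans; cong; cong₂; subst; module ≡-Reasoning)
open import Relation.Nullary using (¬_; Dec; yes; no; contradiction)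

-- The exponents of `fₙ` involve `n ∸ 1`, which is not additive over blocks, and its sum is confined
-- to pairs with join `top`; in that form it cannot be sorted by the join. After complementation the
-- exponents are lengths, which are additive, and the join ranges freely. Two facts about the
-- complement carry the load. Its block count is found locally: at each point, one corner of the
-- diagram contributes minima of blocks of `α` and of `kreweras α`, one in all, with one more at the
-- wrap-around. Its inverse is not built by hand: the square of the complement is conjugation by the
-- long cycle, hence of finite order, and an odd power of the complement is the inverse. Partitions
-- are functions compared pointwise, so a sum is reindexed by double counting over a matrix
-- supported on the graph of a bijection, and summands are shown to respect `≗`.

private
  variable
    a : Level
    X : Set a
    k n : ℕ

-- Boolean tests and the propositions they decide

∧⁻ : ∀ {b c} → b ∧ c ≡ true → b ≡ true × c ≡ true
∧⁻ {true} {true} _ = refl , refl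

∧⁺ : ∀ {b c} → b ≡ true → c ≡ true → b ∧ c ≡ true
∧⁺ refl refl = refl

not⁻ : ∀ {b} → not b ≡ true → b ≢ true
not⁻ {false} _ ()

not⁺ : ∀ {b} → b ≢ true → not b ≡ true
not⁺ {false} _ = refl
not⁺ {true} h = contradiction refl h

⇒⁻ : ∀ {b c} → not b ∨ c ≡ true → b ≡ true → c ≡ true
⇒⁻ {true} h _ = h

⇒⁺ : ∀ {b c} → (b ≡ true → c ≡ true) → not b ∨ c ≡ true
⇒⁺ {false} _ = refl
⇒⁺ {true} h = h refl

true-ext : ∀ {b c} → (b ≡ true → c ≡ true) → (c ≡ true → b ≡ true) → b ≡ c
true-ext {false} {false} f g = refl
true-ext {false} {true} f g = g refl
true-ext {true} {false} f g = sym (f refl)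
true-ext {true} {true} f g = refl

true⇒T : ∀ {b} → b ≡ true → T b
true⇒T refl = _

T⇒true : ∀ {b} → T b → b ≡ true
T⇒true {true} _ = refl

_true? : (b : Bool) → Dec (b ≡ true)
b true? = b Boolₚ.≟ true

==⁻ : {i j : Fin n} → (i == j) ≡ true → i ≡ j
==⁻ {i = i} {j} h with i Finₚ.≟ j
... | yes i≡j = i≡j

==⁺ : {i j : Fin n} → i ≡ j → (i == j) ≡ true
==⁺ {i = i} {j} h with i Finₚ.≟ j
... | yes _ = refl
... | no i≢j = contradiction h i≢j

<ᶠ⁻ : {i j : Fin n} → (i <ᶠ j) ≡ true → i Fin.< j
<ᶠ⁻ {i = i} {j} h = ℕₚ.<ᵇ⇒< (toℕ i) (toℕ j) (true⇒T h)

<ᶠ⁺ : {i j : Fin n} → i Fin.< j → (i <ᶠ j) ≡ true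
<ᶠ⁺ h = T⇒true (ℕₚ.<⇒<ᵇ h)

≤ᶠ⁻ : {i j : Fin n} → (i ≤ᶠ j) ≡ true → i Fin.≤ j
≤ᶠ⁻ {i = i} {j} h = ℕₚ.≤ᵇ⇒≤ (toℕ i) (toℕ j) (true⇒T h)

≤ᶠ⁺ : {i j : Fin n} → i Fin.≤ j → (i ≤ᶠ j) ≡ true
≤ᶠ⁺ h = T⇒true (ℕₚ.≤⇒≤ᵇ h)

all⁻ : (P : X → Bool) {xs : List X} → all P xs ≡ true → ∀ {x} → x ∈ xs → P x ≡ true
all⁻ P h (here refl) = proj₁ (∧⁻ h)
all⁻ P h (there x∈) = all⁻ P (proj₂ (∧⁻ h)) x∈

all⁺ : (P : X → Bool) (xs : List X) → (∀ {x} → x ∈ xs → P x ≡ true) → all P xs ≡ true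
all⁺ P [] h = refl
all⁺ P (x ∷ xs) h = ∧⁺ (h (here refl)) (all⁺ P xs (h ∘ there))

any⁻ : (P : X → Bool) (xs : List X) → any P xs ≡ true → ∃[ x ] x ∈ xs × P x ≡ true
any⁻ P (x ∷ xs) h with P x in eq
... | true = x , here refl , eq
... | false with y , y∈ , Py ← any⁻ P xs h = y , there y∈ , Py

any⁺ : (P : X → Bool) {xs : List X} → ∀ {x} → x ∈ xs → P x ≡ true → any P xs ≡ true
any⁺ P (here refl) h rewrite h = refl
any⁺ P {y ∷ _} (there x∈) h with P y
... | true = refl
... | false = any⁺ P x∈ h

allF⁻ : (P : Fin n → Bool) → allF P ≡ true → ∀ i → P i ≡ true
allF⁻ P h i = all⁻ P {allFin _} h (∈ₚ.∈-allFin i)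

allF⁺ : {P : Fin n → Bool} → (∀ i → P i ≡ true) → allF P ≡ true
allF⁺ {n} {P} h = all⁺ P (allFin n) λ _ → h _

anyF⁻ : (P : Fin n → Bool) → anyF P ≡ true → ∃[ i ] P i ≡ true
anyF⁻ P h with i , _ , Pi ← any⁻ P (allFin _) h = i , Pi

anyF⁺ : {P : Fin n → Bool} (i : Fin n) → P i ≡ true → anyF P ≡ true
anyF⁺ {P = P} i h = any⁺ P (∈ₚ.∈-allFin i) h

≐⁻ : {p q : Partition n} → p ≐ q ≡ true → p ≗ q
≐⁻ {p = p} {q} h i = ==⁻ (allF⁻ (λ i → p i == q i) h i)

≐⁺ : {p q : Partition n} → p ≗ q → p ≐ q ≡ true
≐⁺ {p = p} {q} h = allF⁺ {P = λ i → p i == q i} λ i → ==⁺ (h i)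

≐-refl : (p : Partition n) → p ≐ p ≡ true
≐-refl p = ≐⁺ {p = p} {p} λ _ → refl

filterᵇ-cong : {P Q : X → Bool} → (∀ x → P x ≡ Q x) → ∀ xs → filterᵇ P xs ≡ filterᵇ Q xs
filterᵇ-cong h [] = refl
filterᵇ-cong {P = P} {Q} h (x ∷ xs) with P x | Q x | h x
... | true | _ | refl = cong (x ∷_) (filterᵇ-cong h xs)
... | false | _ | refl = filterᵇ-cong h xs

countF-cong : {P Q : Fin n → Bool} → (∀ i → P i ≡ Q i) → countF P ≡ countF Q
countF-cong h = cong length (filterᵇ-cong h (allFin _))

∈-filterᵇ⁺ : (P : X → Bool) {xs : List X} {x : X} → x ∈ xs → P x ≡ true → x ∈ filterᵇ P xs
∈-filterᵇ⁺ P x∈ h = ∈ₚ.∈-filter⁺ (Boolₚ.T? ∘ P) x∈ (true⇒T h)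

∈-filterᵇ⁻ : (P : X → Bool) (xs : List X) {x : X} → x ∈ filterᵇ P xs → x ∈ xs × P x ≡ true
∈-filterᵇ⁻ P xs x∈ with x∈xs , Px ← ∈ₚ.∈-filter⁻ (Boolₚ.T? ∘ P) x∈ = x∈xs , T⇒true Px

firstSat-sat : (P : Fin n → Bool) (d : Fin n) {xs : List (Fin n)} {j : Fin n} →
  j ∈ xs → P j ≡ true → P (firstSat P d xs) ≡ true
firstSat-sat P d (here refl) h rewrite h = h
firstSat-sat P d {x ∷ _} (there j∈) h with P x in eq
... | true = eq
... | false = firstSat-sat P d j∈ h

firstSat-≤ : (P : Fin n → Bool) (d : Fin n) {xs : List (Fin n)} {j : Fin n} →
  AllPairs Fin._<_ xs → j ∈ xs → P j ≡ true → firstSat P d xs Fin.≤ j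
firstSat-≤ P d _ (here refl) h rewrite h = ℕₚ.≤-refl
firstSat-≤ P d {x ∷ _} (x< ∷ <xs) (there j∈) h with P x
... | true = ℕₚ.<⇒≤ (All.lookup x< j∈)
... | false = firstSat-≤ P d <xs j∈ h

firstSat-none : (P : Fin n → Bool) (d : Fin n) (xs : List (Fin n)) → (∀ j → P j ≢ true) → firstSat P d xs ≡ d
firstSat-none P d [] h = refl
firstSat-none P d (x ∷ xs) h with P x in eq
... | true = contradiction eq (h x)
... | false = firstSat-none P d xs h

firstSat-cong : {P Q : Fin n → Bool} {d e : Fin n} → (∀ i → P i ≡ Q i) → d ≡ e →
  ∀ xs → firstSat P d xs ≡ firstSat Q e xs
firstSat-cong h refl [] = refl
firstSat-cong {P = P} {Q} h refl (x ∷ xs) with P x | Q x | h x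
... | true | _ | refl = refl
... | false | _ | refl = firstSat-cong h refl xs

allFin-sorted : ∀ n → AllPairs Fin._<_ (allFin n)
allFin-sorted n = AllPairsₚ.tabulate⁺-< id

minSat-sat : (P : Fin n → Bool) (d : Fin n) {j : Fin n} → P j ≡ true → P (minSat P d) ≡ true
minSat-sat P d {j} = firstSat-sat P d (∈ₚ.∈-allFin j)

minSat-≤ : (P : Fin n → Bool) (d : Fin n) {j : Fin n} → P j ≡ true → minSat P d Fin.≤ j
minSat-≤ P d {j} = firstSat-≤ P d (allFin-sorted _) (∈ₚ.∈-allFin j)

minSat-none : (P : Fin n → Bool) (d : Fin n) → (∀ j → P j ≢ true) → minSat P d ≡ d
minSat-none P d = firstSat-none P d (allFin _)

minSat-cong : {P Q : Fin n → Bool} {d e : Fin n} → (∀ i → P i ≡ Q i) → d ≡ e → minSat P d ≡ minSat Q e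
minSat-cong h d≡e = firstSat-cong h d≡e (allFin _)

minSat-unique : (P : Fin n → Bool) (d : Fin n) {m : Fin n} → P m ≡ true →
  (∀ j → P j ≡ true → m Fin.≤ j) → minSat P d ≡ m
minSat-unique P d Pm m≤ = Finₚ.≤-antisym (minSat-≤ P d Pm) (m≤ _ (minSat-sat P d Pm))

-- Non-crossing partitions and their lattice

-- The propositional form of the two tests that define `NC`. The crossing condition is stated
-- positively, which is equivalent because equality in `Fin` is decidable.
record Valid (p : Partition n) : Set where
  field
    idem : ∀ i → p (p i) ≡ p i
    dec  : ∀ i → p i Fin.≤ i
    nc   : ∀ {a b c d} → a Fin.< b → b Fin.< c → c Fin.< d → p a ≡ p c → p b ≡ p d → p a ≡ p b

  least : ∀ {i j} → p i ≡ p j → p i Fin.≤ j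
  least pi≡pj = subst (Fin._≤ _) (sym pi≡pj) (dec _)
open Valid

module _ (p : Partition n) where
  private
    isMin : Fin n → Bool
    isMin i = (p (p i) == p i) ∧ (p i ≤ᶠ i)

    cross : Fin n → Fin n → Fin n → Fin n → Bool
    cross a b c d = (a <ᶠ b) ∧ (b <ᶠ c) ∧ (c <ᶠ d) ∧ same p a c ∧ same p b d ∧ not (same p a b)

    cross₁ : Fin n → Bool
    cross₁ a = anyF λ b → anyF λ c → anyF λ d → cross a b c d

    cross₂ : Fin n → Fin n → Bool
    cross₂ a b = anyF λ c → anyF λ d → cross a b c d

    cross₃ : Fin n → Fin n → Fin n → Bool
    cross₃ a b c = anyF λ d → cross a b c d

  NC-test⁻ : isCanonical p ∧ isNonCrossing p ≡ true → Valid p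
  NC-test⁻ h = record
    { idem = λ i → ==⁻ (proj₁ (∧⁻ (allF⁻ isMin (proj₁ (∧⁻ h)) i)))
    ; dec = λ i → ≤ᶠ⁻ {i = p i} {i} (proj₂ (∧⁻ {p (p i) == p i} (allF⁻ isMin (proj₁ (∧⁻ h)) i)))
    ; nc = λ {a} {b} {c} {d} a<b b<c c<d ac bd → go a b c d a<b b<c c<d ac bd (p a Finₚ.≟ p b) }
    where
    go : ∀ a b c d → a Fin.< b → b Fin.< c → c Fin.< d → p a ≡ p c → p b ≡ p d → Dec (p a ≡ p b) → p a ≡ p b
    go a b c d a<b b<c c<d ac bd (yes ab) = ab
    go a b c d a<b b<c c<d ac bd (no ¬ab) = contradiction
      (anyF⁺ {P = cross₁} a (anyF⁺ {P = cross₂ a} b (anyF⁺ {P = cross₃ a b} c (anyF⁺ {P = cross a b c} d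
        (∧⁺ (<ᶠ⁺ {i = a} {b} a<b) (∧⁺ (<ᶠ⁺ {i = b} {c} b<c) (∧⁺ (<ᶠ⁺ {i = c} {d} c<d)
          (∧⁺ (==⁺ ac) (∧⁺ (==⁺ bd) (not⁺ (¬ab ∘ ==⁻)))))))))))
      (not⁻ (proj₂ (∧⁻ {isCanonical p} h)))

  NC-test⁺ : Valid p → isCanonical p ∧ isNonCrossing p ≡ true
  NC-test⁺ v = ∧⁺ {isCanonical p} (allF⁺ {P = isMin} λ i → ∧⁺ (==⁺ (idem v i)) (≤ᶠ⁺ {i = p i} {i} (dec v i)))
                  (not⁺ crossing)
    where
    crossing : anyF cross₁ ≢ true
    crossing h
      with a , h ← anyF⁻ cross₁ h
      with b , h ← anyF⁻ (cross₂ a) h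
      with c , h ← anyF⁻ (cross₃ a b) h
      with d , h ← anyF⁻ (cross a b c) h
      with a<b , h ← ∧⁻ {a <ᶠ b} h
      with b<c , h ← ∧⁻ {b <ᶠ c} h
      with c<d , h ← ∧⁻ {c <ᶠ d} h
      with ac , h ← ∧⁻ {same p a c} h
      with bd , h ← ∧⁻ {same p b d} h
      = not⁻ h (==⁺ (nc v (<ᶠ⁻ {i = a} {b} a<b) (<ᶠ⁻ {i = b} {c} b<c) (<ᶠ⁻ {i = c} {d} c<d) (==⁻ ac) (==⁻ bd)))

∈-vecs : {xs : List X} (v : Vec X k) → (∀ i → Vec.lookup v i ∈ xs) → v ∈ vecs k xs
∈-vecs Vec.[] h = here refl
∈-vecs (x Vec.∷ v) h =
  ∈ₚ.∈-concatMap⁺ (λ y → map (y Vec.∷_) _) (Any.map (λ { refl → ∈ₚ.∈-map⁺ (x Vec.∷_) (∈-vecs v (h ∘ suc)) }) (h zero))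

Valid-resp : {p q : Partition n} → p ≗ q → Valid p → Valid q
Valid-resp {p = p} {q} h v = record
  { idem = lem
  ; dec = λ i → subst (Fin._≤ i) (h i) (dec v i)
  ; nc = λ a<b b<c c<d ac bd →
      trans (sym (h _)) (trans (nc v a<b b<c c<d (back ac) (back bd)) (h _)) }
  where
  back : ∀ {i j} → q i ≡ q j → p i ≡ p j
  back e = trans (h _) (trans e (sym (h _)))
  lem : ∀ i → q (q i) ≡ q i
  lem i = trans (sym (h (q i))) (trans (cong p (sym (h i))) (trans (idem v i) (h i)))

inNC : Partition n → Bool
inNC p = isCanonical p ∧ isNonCrossing p

NC-valid : All Valid (NC n)
NC-valid {n} = All.tabulate λ {p} p∈ → NC-test⁻ p (proj₂ (∈-filterᵇ⁻ inNC (map Vec.lookup (vecs n (allFin n))) p∈))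

-- The list consists of lookup functions of vectors, so a valid function is found in it only up to
-- pointwise equality, through its table.
∈-NC : {p : Partition n} → Valid p → ∃[ q ] q ∈ NC n × q ≗ p
∈-NC {p = p} v = Vec.lookup t , ∈-filterᵇ⁺ inNC (∈ₚ.∈-map⁺ Vec.lookup (∈-vecs t λ _ → ∈ₚ.∈-allFin _))
    (NC-test⁺ (Vec.lookup t) (Valid-resp (λ i → sym (Vecₚ.lookup∘tabulate p i)) v)) , Vecₚ.lookup∘tabulate p
  where t = Vec.tabulate p

infix 4 _⊑_

-- For a canonical α this says that α refines γ.
_⊑_ : Partition n → Partition n → Set
α ⊑ γ = ∀ i → γ (α i) ≡ γ i

⊑-trans : {α β γ : Partition n} → α ⊑ β → β ⊑ γ → α ⊑ γ
⊑-trans {α = α} {β} {γ} αβ βγ i =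
  trans (sym (βγ (α i))) (trans (cong γ (αβ i)) (βγ i))

-- A coarser partition has the smaller block minima: `α (β i)` equals `α i` and is at most `β i`.
-- The other inequality is symmetric.
⊑-antisym : {α β : Partition n} → Valid α → Valid β → α ⊑ β → β ⊑ α → α ≗ β
⊑-antisym {α = α} {β} vα vβ αβ βα i = Finₚ.≤-antisym
  (subst (Fin._≤ β i) (βα i) (dec vα (β i))) (subst (Fin._≤ α i) (αβ i) (dec vβ (α i)))

⊑-resp : {α α′ γ γ′ : Partition n} → α ≗ α′ → γ ≗ γ′ → α ⊑ γ → α′ ⊑ γ′
⊑-resp {γ = γ} hα hγ h i =
  trans (sym (trans (cong γ (hα i)) (hγ _))) (trans (h i) (hγ i))

⊑-same : {α γ : Partition n} → α ⊑ γ → ∀ {i j} → α i ≡ α j → γ i ≡ γ j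
⊑-same {γ = γ} h e = trans (sym (h _)) (trans (cong γ e) (h _))

≗⇒⊑ : {α β : Partition n} → Valid β → α ≗ β → α ⊑ β
≗⇒⊑ {β = β} v h i = trans (cong β (h i)) (idem v i)

≼⁻ : {α γ : Partition n} → Valid α → α ≼ γ ≡ true → α ⊑ γ
≼⁻ {α = α} {γ} v h i = ==⁻ (⇒⁻ (allF⁻ (implies (α i)) (allF⁻ (λ i → allF (implies i)) h (α i)) i) (==⁺ (idem v i)))
  where
  implies : Fin _ → Fin _ → Bool
  implies i j = not (same α i j) ∨ same γ i j

≼⁺ : {α γ : Partition n} → α ⊑ γ → α ≼ γ ≡ true
≼⁺ {α = α} {γ} h = allF⁺ {P = λ i → allF (implies i)} λ i → allF⁺ {P = implies i} λ j →
  ⇒⁺ λ e → ==⁺ (⊑-same h (==⁻ e))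
  where
  implies : Fin _ → Fin _ → Bool
  implies i j = not (same α i j) ∨ same γ i j

-- Partitions as kernels of Boolean equivalence relations

record Equiv (E : Fin n → Fin n → Bool) : Set where
  field
    rfl : ∀ i → E i i ≡ true
    symm : ∀ {i j} → E i j ≡ true → E j i ≡ true
    tran : ∀ {i j l} → E i j ≡ true → E j l ≡ true → E i l ≡ true

-- The meet, `top`, the cycle partition of a permutation and the Kreweras complement all unfold to
-- this form, each with its own `E`.
ker : (Fin n → Fin n → Bool) → Partition n
ker E i = minSat (E i) i

module Kernel {E : Fin n → Fin n → Bool} (eqv : Equiv E) where
  open Equiv eqv

  ker-rel : ∀ i → E i (ker E i) ≡ true
  ker-rel i = minSat-sat (E i) i (rfl i)

  ker-dec : ∀ i → ker E i Fin.≤ i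
  ker-dec i = minSat-≤ (E i) i (rfl i)

  ker-≡ : ∀ {i j} → E i j ≡ true → ker E i ≡ ker E j
  ker-≡ {i} {j} e = Finₚ.≤-antisym (minSat-≤ (E i) i (tran e (ker-rel j)))
                                   (minSat-≤ (E j) j (tran (symm e) (ker-rel i)))

  ker-≡⁻ : ∀ {i j} → ker E i ≡ ker E j → E i j ≡ true
  ker-≡⁻ {i} {j} e = tran (ker-rel i) (subst (λ m → E m j ≡ true) (sym e) (symm (ker-rel j)))

  ker-idem : ∀ i → ker E (ker E i) ≡ ker E i
  ker-idem i = sym (ker-≡ (ker-rel i))

  ker-valid : (∀ {a b c d} → a Fin.< b → b Fin.< c → c Fin.< d → E a c ≡ true → E b d ≡ true → E a b ≡ true) →
    Valid (ker E)
  ker-valid h = record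
    { idem = ker-idem
    ; dec = ker-dec
    ; nc = λ a<b b<c c<d ac bd → ker-≡ (h a<b b<c c<d (ker-≡⁻ ac) (ker-≡⁻ bd)) }

module _ (α β : Partition n) where
  private
    E : Fin n → Fin n → Bool
    E i j = same α i j ∧ same β i j

    E⁻ : ∀ {i j} → E i j ≡ true → α i ≡ α j × β i ≡ β j
    E⁻ h with p , q ← ∧⁻ h = ==⁻ p , ==⁻ q

    E⁺ : ∀ {i j} → α i ≡ α j → β i ≡ β j → E i j ≡ true
    E⁺ p q = ∧⁺ (==⁺ p) (==⁺ q)

    eqv : Equiv E
    eqv = record
      { rfl = λ i → E⁺ refl refl
      ; symm = λ h → let p , q = E⁻ h in E⁺ (sym p) (sym q)
      ; tran = λ h h′ → let p , q = E⁻ h; p′ , q′ = E⁻ h′ in E⁺ (trans p p′) (trans q q′) }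
    open Kernel eqv

  meet-⊑ˡ : (α ∧ₙ β) ⊑ α
  meet-⊑ˡ i = sym (proj₁ (E⁻ (ker-rel i)))

  meet-⊑ʳ : (α ∧ₙ β) ⊑ β
  meet-⊑ʳ i = sym (proj₂ (E⁻ (ker-rel i)))

  meet-greatest : ∀ {γ} → γ ⊑ α → γ ⊑ β → γ ⊑ (α ∧ₙ β)
  meet-greatest hα hβ i = ker-≡ (E⁺ (hα i) (hβ i))

  meet-same : ∀ {i j} → α i ≡ α j → β i ≡ β j → (α ∧ₙ β) i ≡ (α ∧ₙ β) j
  meet-same p q = ker-≡ (E⁺ p q)

  meet-valid : Valid α → Valid β → Valid (α ∧ₙ β)
  meet-valid vα vβ = ker-valid λ a<b b<c c<d ac bd →
    let p , q = E⁻ ac; p′ , q′ = E⁻ bd in E⁺ (nc vα a<b b<c c<d p p′) (nc vβ a<b b<c c<d q q′)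

top-equiv : Equiv {n} (λ _ _ → true)
top-equiv = record { rfl = λ _ → refl ; symm = λ _ → refl ; tran = λ _ _ → refl }

top-same : (i j : Fin n) → top i ≡ top j
top-same i j = Kernel.ker-≡ top-equiv {i} {j} refl

top-valid : Valid {n} top
top-valid = Kernel.ker-valid top-equiv λ _ _ _ _ _ → refl

⊑-top : (α : Partition n) → α ⊑ top
⊑-top α i = top-same (α i) i

bot-valid : Valid {n} bot
bot-valid = record
  { idem = λ _ → refl
  ; dec = λ _ → ℕₚ.≤-refl
  ; nc = λ { a<b b<c _ refl _ → contradiction (ℕₚ.<-trans a<b b<c) (ℕₚ.<-irrefl refl) } }

bot-⊑ : (α : Partition n) → bot ⊑ α
bot-⊑ α i = refl

top-⊑ : {α : Partition n} → Valid α → top ⊑ α → α ≗ top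
top-⊑ {α = α} v h = ⊑-antisym v top-valid (⊑-top α) h

-- `_∨ₙ_` evaluates a meet over a filtered list. This universal property is what can be moved along
-- `≗`, through the complement and to the parts of a split partition.
record IsJoin (α β σ : Partition n) : Set where
  field
    upperˡ : α ⊑ σ
    upperʳ : β ⊑ σ
    minimal : ∀ {γ} → Valid γ → α ⊑ γ → β ⊑ γ → σ ⊑ γ
open IsJoin

IsJoin-resp : {α α′ β β′ σ σ′ : Partition n} → α ≗ α′ → β ≗ β′ → σ ≗ σ′ → IsJoin α β σ → IsJoin α′ β′ σ′
IsJoin-resp hα hβ hσ J = record
  { upperˡ = ⊑-resp hα hσ (upperˡ J)
  ; upperʳ = ⊑-resp hβ hσ (upperʳ J)
  ; minimal = λ vγ p q → ⊑-resp hσ (λ _ → refl)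
      (minimal J vγ (⊑-resp (λ i → sym (hα i)) (λ _ → refl) p) (⊑-resp (λ i → sym (hβ i)) (λ _ → refl) q)) }

module _ {α β : Partition n} (vα : Valid α) (vβ : Valid β) where
  private
    meets : List (Partition n) → Partition n
    meets = foldr _∧ₙ_ top

    meets-valid : ∀ {γs} → All Valid γs → Valid (meets γs)
    meets-valid [] = top-valid
    meets-valid (v ∷ vs) = meet-valid _ _ v (meets-valid vs)

    meets-lower : ∀ {γ γs} → γ ∈ γs → meets γs ⊑ γ
    meets-lower {γs = γ ∷ γs} (here refl) = meet-⊑ˡ γ (meets γs)
    meets-lower {γs = γ ∷ γs} (there h) = ⊑-trans (meet-⊑ʳ γ (meets γs)) (meets-lower h)

    meets-greatest : ∀ δ γs → All (δ ⊑_) γs → δ ⊑ meets γs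
    meets-greatest δ [] [] = ⊑-top δ
    meets-greatest δ (γ ∷ γs) (h ∷ hs) = meet-greatest γ (meets γs) h (meets-greatest δ γs hs)

    upper : Partition n → Bool
    upper γ = (α ≼ γ) ∧ (β ≼ γ)

  join-valid : Valid (α ∨ₙ β)
  join-valid = meets-valid (All.tabulate λ {p} p∈ → All.lookup NC-valid (proj₁ (∈-filterᵇ⁻ upper (NC n) p∈)))

  join-isJoin : IsJoin α β (α ∨ₙ β)
  join-isJoin = record
    { upperˡ = meets-greatest α (filterᵇ upper (NC n)) (All.tabulate λ {γ} p∈ → ≼⁻ vα
        (proj₁ (∧⁻ {α ≼ γ} (proj₂ (∈-filterᵇ⁻ upper (NC n) p∈)))))
    ; upperʳ = meets-greatest β (filterᵇ upper (NC n)) (All.tabulate λ {γ} p∈ → ≼⁻ vβ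
        (proj₂ (∧⁻ {α ≼ γ} (proj₂ (∈-filterᵇ⁻ upper (NC n) p∈)))))
    -- The meet runs over listed partitions only, so `γ` is replaced by its representative in
    -- `NC n`.
    ; minimal = λ vγ p q → let γ′ , γ′∈ , γ′≗ = ∈-NC vγ
                               back = λ i → sym (γ′≗ i) in
        ⊑-resp (λ _ → refl) γ′≗ (meets-lower (∈-filterᵇ⁺ upper γ′∈
          (∧⁺ (≼⁺ (⊑-resp (λ _ → refl) back p)) (≼⁺ (⊑-resp (λ _ → refl) back q))))) }

  join⁻ : ∀ {σ} → (α ∨ₙ β) ≐ σ ≡ true → IsJoin α β σ
  join⁻ h = IsJoin-resp (λ _ → refl) (λ _ → refl) (≐⁻ h) join-isJoin

  join⁺ : ∀ {σ} → Valid σ → IsJoin α β σ → (α ∨ₙ β) ≐ σ ≡ true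
  join⁺ vσ J = ≐⁺ (⊑-antisym join-valid vσ
    (minimal join-isJoin vσ (upperˡ J) (upperʳ J)) (minimal J join-valid (upperˡ join-isJoin) (upperʳ join-isJoin)))
-- Orbits and cycles

Inj : Perm n → Set
Inj σ = ∀ {i j} → σ i ≡ σ j → i ≡ j

iter-+ : (σ : Perm n) → ∀ x y i → iter σ (x + y) i ≡ iter σ x (iter σ y i)
iter-+ σ zero y i = refl
iter-+ σ (suc x) y i = cong σ (iter-+ σ x y i)

iter-inj : {σ : Perm n} → Inj σ → ∀ k → Inj (iter σ k)
iter-inj inj zero e = e
iter-inj inj (suc k) e = iter-inj inj k (inj e)

iter-cong : {σ τ : Perm n} → σ ≗ τ → ∀ k → iter σ k ≗ iter τ k
iter-cong h zero i = refl
iter-cong {τ = τ} h (suc k) i = trans (h _) (cong τ (iter-cong h k i))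

iter-repeats : (σ : Perm n) (i : Fin n) → ∃[ x ] ∃[ y ] x ℕ.< y × y ≤ n × iter σ x i ≡ iter σ y i
iter-repeats {n} σ i with x , y , x<y , e ← Finₚ.pigeonhole (ℕₚ.n<1+n n) (λ m → iter σ (toℕ m) i) =
  toℕ x , toℕ y , x<y , ℕₚ.≤-pred (Finₚ.toℕ<n y) , e

-- Pigeonhole gives exponents `x < y ≤ n` with equal iterates, so any `m ≥ n` can be lowered to
-- `m ∸ y + x`. This is why `cycles` may test only exponents below `n`.
iter-bounded : (σ : Perm n) (i : Fin n) → ∀ m → ∃[ k ] k ℕ.< n × iter σ k i ≡ iter σ m i
iter-bounded {n} σ i = ℕᵢ.<-rec _ bound
  where
  bound : ∀ m → (∀ {l} → l ℕ.< m → ∃[ k ] k ℕ.< n × iter σ k i ≡ iter σ l i) → ∃[ k ] k ℕ.< n × iter σ k i ≡ iter σ m i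
  bound m rec with m ℕ.<? n
  ... | yes m<n = m , m<n , refl
  ... | no m≮n with x , y , x<y , y≤n , e ← iter-repeats σ i =
    let y≤m = ℕₚ.≤-trans y≤n (ℕₚ.≮⇒≥ m≮n)
        k , k<n , e′ = rec {m ∸ y + x} (subst (m ∸ y + x ℕ.<_) (ℕₚ.m∸n+n≡m y≤m) (ℕₚ.+-monoʳ-< (m ∸ y) x<y))
    in k , k<n , trans e′ (trans (iter-+ σ (m ∸ y) x i) (trans (cong (iter σ (m ∸ y)) e)
         (trans (sym (iter-+ σ (m ∸ y) y i)) (cong (λ l → iter σ l i) (ℕₚ.m∸n+n≡m y≤m)))))

-- Two equal iterates of `i` become a return to `i` once the shorter power, which is injective, is
-- cancelled.
iter-returns : {σ : Perm n} → Inj σ → ∀ i → ∃[ k ] iter σ (suc k) i ≡ i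
iter-returns {σ = σ} inj i with x , suc y , s≤s x≤y , _ , e ← iter-repeats σ i =
  y ∸ x , iter-inj inj x (sym (trans e (trans (cong (λ l → iter σ l i) eq) (iter-+ σ x (suc (y ∸ x)) i))))
  where
  eq : suc y ≡ x + suc (y ∸ x)
  eq = trans (cong suc (sym (ℕₚ.m+[n∸m]≡n x≤y))) (sym (ℕₚ.+-suc x (y ∸ x)))

surj : {σ : Perm n} → Inj σ → ∀ i → ∃[ j ] σ j ≡ i
surj {σ = σ} inj i with k , e ← iter-returns inj i = iter σ k i , e

module _ {σ : Perm n} (inj : Inj σ) where
  inv-sat : ∀ {i j} → σ j ≡ i → σ (inv σ i) ≡ i
  inv-sat {i} e = ==⁻ (minSat-sat (λ j → σ j == i) i (==⁺ e))

  inv-inverseʳ : ∀ i → σ (inv σ i) ≡ i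
  inv-inverseʳ i = inv-sat (proj₂ (surj inj i))

  inv-inverseˡ : ∀ i → inv σ (σ i) ≡ i
  inv-inverseˡ i = inj (inv-sat refl)

  inv-unique : ∀ {i j} → σ j ≡ i → inv σ i ≡ j
  inv-unique e = inj (trans (inv-sat e) (sym e))

  inv-inj : Inj (inv σ)
  inv-inj e = trans (sym (inv-inverseʳ _)) (trans (cong σ e) (inv-inverseʳ _))

inv-cong : {σ τ : Perm n} → σ ≗ τ → inv σ ≗ inv τ
inv-cong h i = minSat-cong (λ j → cong (_== i) (h j)) refl

Orb : Perm n → Fin n → Fin n → Set
Orb σ i j = ∃[ k ] iter σ k i ≡ j

module _ {σ : Perm n} where
  orb-refl : ∀ {i} → Orb σ i i
  orb-refl = 0 , refl

  orb-step : ∀ i → Orb σ i (σ i)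
  orb-step i = 1 , refl

  orb-trans : ∀ {i j l} → Orb σ i j → Orb σ j l → Orb σ i l
  orb-trans {i} (x , refl) (y , refl) = y + x , iter-+ σ y x i

  orb-preserves : {q : Fin n → Fin n} → (∀ i → q (σ i) ≡ q i) → ∀ {i j} → Orb σ i j → q j ≡ q i
  orb-preserves h (zero , refl) = refl
  orb-preserves h (suc k , refl) = trans (h _) (orb-preserves h (k , refl))

  -- Orbits are defined by forward iterates only; a backward step is obtained by going around the
  -- rest of the cycle.
  orb-sym : Inj σ → ∀ {i j} → Orb σ i j → Orb σ j i
  orb-sym inj (zero , refl) = orb-refl
  orb-sym inj {i} (suc k , refl) = orb-trans (back (iter σ k i)) (orb-sym inj (k , refl))
    where
    back : ∀ i → Orb σ (σ i) i
    back i with k , e ← iter-returns inj i =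
      k , trans (sym (iter-+ σ k 1 i)) (trans (cong (λ l → iter σ l i) (ℕₚ.+-comm k 1)) e)

orb-cong : {σ τ : Perm n} → σ ≗ τ → ∀ {i j} → Orb σ i j → Orb τ i j
orb-cong h (k , e) = k , trans (sym (iter-cong h k _)) e

module _ (σ : Perm n) where
  orbE : Fin n → Fin n → Bool
  orbE i j = any (λ k → iter σ k i == j) (upTo n)

  orbE⁻ : ∀ {i j} → orbE i j ≡ true → Orb σ i j
  orbE⁻ {i} {j} h with k , _ , e ← any⁻ (λ k → iter σ k i == j) (upTo n) h = k , ==⁻ e

  orbE⁺ : ∀ {i j} → Orb σ i j → orbE i j ≡ true
  orbE⁺ {i} {j} (m , e) with k , k<n , e′ ← iter-bounded σ i m =
    any⁺ (λ k → iter σ k i == j) (∈ₚ.∈-upTo⁺ k<n) (==⁺ (trans e′ e))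

  cycleMin : Fin n → Bool
  cycleMin i = all (λ k → i ≤ᶠ iter σ k i) (upTo n)

  cycleMin⁻ : ∀ {i j} → cycleMin i ≡ true → Orb σ i j → i Fin.≤ j
  cycleMin⁻ {i} h (m , refl) with k , k<n , e ← iter-bounded σ i m =
    subst (i Fin.≤_) e (≤ᶠ⁻ {i = i} {iter σ k i} (all⁻ (λ k → i ≤ᶠ iter σ k i) h (∈ₚ.∈-upTo⁺ k<n)))

  cycleMin⁺ : ∀ {i} → (∀ {j} → Orb σ i j → i Fin.≤ j) → cycleMin i ≡ true
  cycleMin⁺ {i} h = all⁺ (λ k → i ≤ᶠ iter σ k i) (upTo n) λ {k} _ → ≤ᶠ⁺ {i = i} {iter σ k i} (h (k , refl))

blocks : Partition n → ℕ
blocks p = countF (λ i → p i == i)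

-- `cycles` counts the points that are least in their cycle and `blocks` the fixed points of `p`. If
-- the classes of `p` are the orbits of `σ`, these are the same points.
cycles-blocks : {σ : Perm n} {p : Partition n} → (∀ i → p (p i) ≡ p i) → (∀ i → p i Fin.≤ i) →
  (∀ {i j} → Orb σ i j → p i ≡ p j) → (∀ {i j} → p i ≡ p j → Orb σ i j) → cycles σ ≡ blocks p
cycles-blocks {σ = σ} {p} idem dec orb⇒ ⇒orb = countF-cong λ i → true-ext
  (λ h → ==⁺ (Finₚ.≤-antisym (dec i) (cycleMin⁻ σ {i} h (⇒orb (sym (idem i))))))
  (λ h → cycleMin⁺ σ {i} λ {j} o → subst (Fin._≤ j) (trans (sym (orb⇒ o)) (==⁻ h)) (dec j))

orbit : Perm n → Partition n
orbit σ = ker (orbE σ)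

module _ {σ : Perm n} (inj : Inj σ) where
  orbE-equiv : Equiv (orbE σ)
  orbE-equiv = record
    { rfl = λ i → orbE⁺ σ orb-refl
    ; symm = λ h → orbE⁺ σ (orb-sym inj (orbE⁻ σ h))
    ; tran = λ h h′ → orbE⁺ σ (orb-trans (orbE⁻ σ h) (orbE⁻ σ h′)) }

  open Kernel orbE-equiv

  orbit-idem : ∀ i → orbit σ (orbit σ i) ≡ orbit σ i
  orbit-idem = ker-idem

  orbit-≡ : ∀ {i j} → Orb σ i j → orbit σ i ≡ orbit σ j
  orbit-≡ o = ker-≡ (orbE⁺ σ o)

  orbit-≡⁻ : ∀ {i j} → orbit σ i ≡ orbit σ j → Orb σ i j
  orbit-≡⁻ e = orbE⁻ σ (ker-≡⁻ e)

  cycles-orbit : cycles σ ≡ blocks (orbit σ)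
  cycles-orbit = cycles-blocks ker-idem ker-dec orbit-≡ orbit-≡⁻

cycles-cong : {σ τ : Perm n} → σ ≗ τ → cycles σ ≡ cycles τ
cycles-cong {σ = σ} {τ} h = countF-cong {P = cycleMin σ} {cycleMin τ} λ i → true-ext
  (λ c → cycleMin⁺ τ {i} λ o → cycleMin⁻ σ {i} c (orb-cong (λ j → sym (h j)) o))
  (λ c → cycleMin⁺ σ {i} λ o → cycleMin⁻ τ {i} c (orb-cong h o))

cycles≤n : (σ : Perm n) → cycles σ ≤ n
cycles≤n {n} σ = subst (cycles σ ≤_) (Listₚ.length-tabulate id)
  (Listₚ.length-filter (Boolₚ.T? ∘ cycleMin σ) (allFin n))

-- The permutation of a partition

data Next (p : Partition n) (i j : Fin n) : Set where
  step : i Fin.< j → p j ≡ p i → (∀ {k} → i Fin.< k → p k ≡ p i → j Fin.≤ k) → Next p i j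
  wrap : j ≡ p i → (∀ {k} → p k ≡ p i → k Fin.≤ i) → Next p i j

module _ (p : Partition n) where
  private
    after : Fin n → Fin n → Bool
    after i j = same p i j ∧ (i <ᶠ j)

    after⁺ : ∀ {i j} → p j ≡ p i → i Fin.< j → after i j ≡ true
    after⁺ {i} {j} e l = ∧⁺ (==⁺ (sym e)) (<ᶠ⁺ {i = i} {j} l)

    after⁻ : ∀ {i j} → after i j ≡ true → p j ≡ p i × i Fin.< j
    after⁻ {i} {j} h = sym (==⁻ (proj₁ (∧⁻ h))) , <ᶠ⁻ {i = i} {j} (proj₂ (∧⁻ {same p i j} h))

  -- The default value `p i` in `perm` is reached when the block has no element after `i`, which is
  -- the `wrap` case.
  next-perm : ∀ i → Next p i (perm p i)
  next-perm i with after i (perm p i) true?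
  ... | yes h = step (proj₂ (after⁻ h)) (proj₁ (after⁻ h)) λ l e → minSat-≤ (after i) (p i) (after⁺ e l)
  ... | no ¬h = wrap (minSat-none (after i) (p i) none) λ {k} e → ℕₚ.≮⇒≥ λ l → none k (after⁺ e l)
    where
    none : ∀ k → after i k ≢ true
    none k h = ¬h (minSat-sat (after i) (p i) h)

  next-unique : ∀ {i j} → Next p i j → perm p i ≡ j
  next-unique {i} (step l e h) = minSat-unique (after i) (p i) (after⁺ e l) λ k h′ →
    let e′ , l′ = after⁻ h′ in h l′ e′
  next-unique {i} (wrap refl h) = minSat-none (after i) (p i) λ k h′ →
    let e′ , l′ = after⁻ h′ in ℕₚ.<⇒≱ l′ (h e′)

perm-cong : {p q : Partition n} → p ≗ q → perm p ≗ perm q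
perm-cong h i = minSat-cong (λ j → cong₂ _∧_ (cong₂ _==_ (h i) (h j)) refl) (h i)

module _ {p : Partition n} (v : Valid p) where
  next-same : ∀ {i j} → Next p i j → p j ≡ p i
  next-same (step _ e _) = e
  next-same {i} (wrap refl _) = idem v i

  perm-same : ∀ i → p (perm p i) ≡ p i
  perm-same i = next-same (next-perm p i)

  -- Two steps to one target: the earlier source would have its successor at or before the later
  -- source, hence before the target. A step never lands on a block minimum, where a wrap does. Two
  -- wraps start at the maximum of the same block.
  perm-inj : Inj (perm p)
  perm-inj {i} {j} e = next-inj (next-perm p i) (subst (Next p j) (sym e) (next-perm p j))
    where
    next-inj : ∀ {i j l} → Next p i l → Next p j l → i ≡ j
    next-inj {i} {j} (step i<l e h) (step j<l e′ h′) with Finₚ.<-cmp i j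
    ... | tri< i<j _ _ = contradiction (h i<j (trans (sym e′) e)) (ℕₚ.<⇒≱ j<l)
    ... | tri≈ _ i≡j _ = i≡j
    ... | tri> _ _ j<i = contradiction (h′ j<i (trans (sym e) e′)) (ℕₚ.<⇒≱ i<l)
    next-inj {i} {j} (step i<l e h) (wrap refl h′) =
      contradiction (least v {j} {i} (trans (sym (idem v j)) e)) (ℕₚ.<⇒≱ i<l)
    next-inj {i} {j} (wrap refl h) (step j<l e′ h′) =
      contradiction (least v {i} {j} (trans (sym (idem v i)) e′)) (ℕₚ.<⇒≱ j<l)
    next-inj {i} {j} (wrap l≡pi h) (wrap l≡pj h′) =
      let e = trans (sym l≡pi) l≡pj in Finₚ.≤-antisym (h′ e) (h (sym e))

  private
    -- Induction on a bound `m` for the distance from `j` to `i`: the successor of `j` in the block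
    -- does not overshoot `i`.
    walk : ∀ {i} m {j} → toℕ i ∸ toℕ j ≤ m → j Fin.≤ i → p j ≡ p i → Orb (perm p) j i
    walk {i} m {j} i∸j≤m j≤i e with j Finₚ.≟ i
    ... | yes refl = orb-refl
    ... | no j≢i = go m i∸j≤m (next-perm p j)
      where
      j<i : j Fin.< i
      j<i = Finₚ.≤∧≢⇒< j≤i j≢i
      go : ∀ m → toℕ i ∸ toℕ j ≤ m → Next p j (perm p j) → Orb (perm p) j i
      go m _ (wrap _ h) = contradiction (h (sym e)) (ℕₚ.<⇒≱ j<i)
      go zero i∸j≤0 (step l e′ h) = contradiction (ℕₚ.m∸n≡0⇒m≤n (ℕₚ.n≤0⇒n≡0 i∸j≤0)) (ℕₚ.<⇒≱ j<i)
      go (suc m) i∸j≤m (step l e′ h) = orb-trans (orb-step j)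
        (walk m (ℕₚ.≤-pred (ℕₚ.≤-trans (ℕₚ.∸-monoʳ-< l (h j<i (sym e))) i∸j≤m)) (h j<i (sym e)) (trans e′ e))

  orb-perm : ∀ {i j} → p i ≡ p j → Orb (perm p) i j
  orb-perm {i} {j} e = orb-trans (orb-sym perm-inj (from-min i)) (subst (λ m → Orb (perm p) m j) (sym e) (from-min j))
    where
    from-min : ∀ i → Orb (perm p) (p i) i
    from-min i = walk (toℕ i) (ℕₚ.m∸n≤m (toℕ i) (toℕ (p i))) (dec v i) (idem v i)

  cycles-perm : cycles (perm p) ≡ blocks p
  cycles-perm = cycles-blocks (idem v) (dec v) (λ o → sym (orb-preserves perm-same o)) orb-perm

-- The blocks are recovered as the orbits of the permutation.
perm-injective : {p q : Partition n} → Valid p → Valid q → perm p ≗ perm q → p ≗ q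
perm-injective vp vq h = ⊑-antisym vp vq (finer vp vq h) (finer vq vp (λ i → sym (h i)))
  where
  finer : {p q : Partition n} → Valid p → Valid q → perm p ≗ perm q → p ⊑ q
  finer {p = p} vp vq h i = sym (orb-preserves (perm-same vq) (orb-cong h (orb-perm vp (idem vp i))))
-- Finite sums

if-true : {b : Bool} {x y : X} → b ≡ true → (if b then x else y) ≡ x
if-true refl = refl

if-false : {b : Bool} {x y : X} → b ≢ true → (if b then x else y) ≡ y
if-false {b = false} h = refl
if-false {b = true} h = contradiction refl h

-- Stated for any commutative monoid, so that one set of lemmas serves both counting in `ℕ` and sums
-- in the ring.
module Sum {c ℓ} (M : CommutativeMonoid c ℓ) where
  open CommutativeMonoid M renaming (refl to ≈-refl; sym to ≈-sym; trans to ≈-trans)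
  open import Relation.Binary.Reasoning.Setoid setoid
  open import Algebra.Properties.CommutativeSemigroup commutativeSemigroup using (interchange)

  private
    variable
      b p q : Level
      V : Set a
      W : Set b

  sum : List V → (V → Carrier) → Carrier
  sum xs h = foldr (λ x s → h x ∙ s) ε xs

  sum-cong-All : {P : V → Set p} {xs : List V} {f g : V → Carrier} → All P xs →
    (∀ {x} → P x → f x ≈ g x) → sum xs f ≈ sum xs g
  sum-cong-All [] h = ≈-refl
  sum-cong-All (px ∷ pxs) h = ∙-cong (h px) (sum-cong-All pxs h)

  sum-cong : (xs : List V) {f g : V → Carrier} → (∀ x → f x ≈ g x) → sum xs f ≈ sum xs g
  sum-cong [] h = ≈-refl
  sum-cong (x ∷ xs) h = ∙-cong (h x) (sum-cong xs h)

  sum-ε : (xs : List V) {f : V → Carrier} → (∀ x → f x ≈ ε) → sum xs f ≈ ε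
  sum-ε [] h = ≈-refl
  sum-ε (x ∷ xs) h = ≈-trans (∙-cong (h x) (sum-ε xs h)) (identityˡ ε)

  sum-∙ : (xs : List V) (f g : V → Carrier) → sum xs (λ x → f x ∙ g x) ≈ sum xs f ∙ sum xs g
  sum-∙ [] f g = ≈-sym (identityˡ ε)
  sum-∙ (x ∷ xs) f g = ≈-trans (∙-congˡ (sum-∙ xs f g)) (interchange (f x) (g x) (sum xs f) (sum xs g))

  sum-swap : (xs : List V) (ys : List W) (f : V → W → Carrier) →
    sum xs (λ x → sum ys (f x)) ≈ sum ys (λ y → sum xs (λ x → f x y))
  sum-swap [] ys f = ≈-sym (sum-ε ys λ _ → ≈-refl)
  sum-swap (x ∷ xs) ys f = ≈-trans (∙-congˡ (sum-swap xs ys f)) (≈-sym (sum-∙ ys (f x) _))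

  sum-++ : (xs ys : List V) (f : V → Carrier) → sum (xs ++ ys) f ≈ sum xs f ∙ sum ys f
  sum-++ [] ys f = ≈-sym (identityˡ _)
  sum-++ (x ∷ xs) ys f = ≈-trans (∙-congˡ (sum-++ xs ys f)) (≈-sym (assoc _ _ _))

  sum-map : (g : W → V) (xs : List W) (f : V → Carrier) → sum (map g xs) f ≈ sum xs (f ∘ g)
  sum-map g [] f = ≈-refl
  sum-map g (x ∷ xs) f = ∙-congˡ (sum-map g xs f)

  sum-concatMap : (g : W → List V) (xs : List W) (f : V → Carrier) →
    sum (concatMap g xs) f ≈ sum xs (λ x → sum (g x) f)
  sum-concatMap g [] f = ≈-refl
  sum-concatMap g (x ∷ xs) f = ≈-trans (sum-++ (g x) (concatMap g xs) f) (∙-congˡ (sum-concatMap g xs f))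

  sum-filterᵇ : (P : V → Bool) (xs : List V) {f g : V → Carrier} →
    (∀ {x} → P x ≡ true → f x ≈ g x) → (∀ {x} → P x ≢ true → g x ≈ ε) → sum (filterᵇ P xs) f ≈ sum xs g
  sum-filterᵇ P [] h h′ = ≈-refl
  sum-filterᵇ P (x ∷ xs) h h′ with P x in eq
  ... | true = ∙-cong (h eq) (sum-filterᵇ P xs h h′)
  ... | false = ≈-trans (sum-filterᵇ P xs h h′)
    (≈-sym (≈-trans (∙-congʳ (h′ λ eq′ → contradiction (trans (sym eq) eq′) λ ())) (identityˡ _)))

  -- Double counting: `f` lists the row sums and `g` the column sums of the matrix `m`. `P` and `Q`
  -- carry the validity of the entries of the two lists.
  sum-double : {P : V → Set p} {Q : W → Set q} {xs : List V} {ys : List W}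
    (m : V → W → Carrier) {f : V → Carrier} {g : W → Carrier} → All P xs → All Q ys →
    (∀ {x} → P x → sum ys (m x) ≈ f x) → (∀ {y} → Q y → sum xs (λ x → m x y) ≈ g y) → sum xs f ≈ sum ys g
  sum-double {xs = xs} {ys} m ps qs h h′ =
    ≈-trans (≈-sym (sum-cong-All ps h)) (≈-trans (sum-swap xs ys m) (sum-cong-All qs h′))

  sum-tabulate : (t : Fin n → V) (f : V → Carrier) → sum (List.tabulate t) f ≈ sum (allFin n) (f ∘ t)
  sum-tabulate {n = n} t f = ≈-trans
    (reflexive (cong (λ xs → sum xs f) (sym (Listₚ.map-tabulate id t)))) (sum-map t (allFin n) f)

  sum-lookup : (xs : List V) (f : V → Carrier) → sum xs f ≈ sum (allFin (length xs)) (f ∘ List.lookup xs)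
  sum-lookup xs f = ≈-trans (reflexive (cong (λ ys → sum ys f) (sym (Listₚ.tabulate-lookup xs))))
                            (sum-tabulate (List.lookup xs) f)

  allFin-single : (i : Fin n) (u : Fin n → Carrier) → (∀ {j} → j ≢ i → u j ≈ ε) → sum (allFin n) u ≈ u i
  allFin-single {suc n} zero u h = ≈-trans
    (∙-congˡ (≈-trans (sum-tabulate suc u) (sum-ε (allFin n) λ j → h λ ()))) (identityʳ _)
  allFin-single {suc n} (suc i) u h = ≈-trans
    (∙-cong (h λ ()) (≈-trans (sum-tabulate suc u) (allFin-single i (u ∘ suc) λ ne → h (ne ∘ Finₚ.suc-injective))))
    (identityˡ _)

  vecs-single : (v : Vec (Fin n) k) (u : Vec (Fin n) k → Carrier) → (∀ {w} → w ≢ v → u w ≈ ε) →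
    sum (vecs k (allFin n)) u ≈ u v
  vecs-single Vec.[] u h = identityʳ _
  vecs-single {n = n} {suc k} (i Vec.∷ v) u h = begin
    sum (vecs (suc k) (allFin n)) u
      ≈⟨ sum-concatMap _ (allFin n) u ⟩
    sum (allFin n) (λ j → sum (map (j Vec.∷_) (vecs k (allFin n))) u)
      ≈⟨ sum-cong (allFin n) (λ j → sum-map (j Vec.∷_) (vecs k (allFin n)) u) ⟩
    sum (allFin n) (λ j → sum (vecs k (allFin n)) (λ w → u (j Vec.∷ w)))
      ≈⟨ allFin-single i _ (λ j≢i → sum-ε (vecs k (allFin n)) λ w → h (j≢i ∘ cong Vec.head)) ⟩
    sum (vecs k (allFin n)) (λ w → u (i Vec.∷ w))
      ≈⟨ vecs-single v _ (λ w≢v → h (w≢v ∘ cong Vec.tail)) ⟩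
    u (i Vec.∷ v) ∎

  -- This is where `NC` is seen to list each partition just once: the only vector whose lookup
  -- function agrees with `p` is the table of `p`.
  NC-single : {p : Partition n} → Valid p → (u : Partition n → Carrier) →
    (∀ {q} → Valid q → q ≗ p → u q ≈ u p) → (∀ {q} → Valid q → ¬ q ≗ p → u q ≈ ε) → sum (NC n) u ≈ u p
  NC-single {n} {p} v u h h′ = begin
    sum (NC n) u
      ≈⟨ sum-filterᵇ inNC (map Vec.lookup (vecs n (allFin n))) {g = u′} (λ e → reflexive (sym (if-true e)))
           (λ ne → reflexive (if-false ne)) ⟩
    sum (map Vec.lookup (vecs n (allFin n))) u′
      ≈⟨ sum-map Vec.lookup (vecs n (allFin n)) u′ ⟩
    sum (vecs n (allFin n)) (u′ ∘ Vec.lookup)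
      ≈⟨ vecs-single (Vec.tabulate p) _ (λ {w} ne → zero-off w (ne ∘ pointwise w) (inNC (Vec.lookup w) true?)) ⟩
    u′ p′
      ≡⟨ if-true (NC-test⁺ p′ v′) ⟩
    u p′
      ≈⟨ h v′ p′≗p ⟩
    u p ∎
    where
    p′ : Partition n
    p′ = Vec.lookup (Vec.tabulate p)
    p′≗p : p′ ≗ p
    p′≗p = Vecₚ.lookup∘tabulate p
    v′ : Valid p′
    v′ = Valid-resp (λ i → sym (p′≗p i)) v
    u′ : Partition n → Carrier
    u′ q = if inNC q then u q else ε
    pointwise : ∀ w → Vec.lookup w ≗ p → w ≡ Vec.tabulate p
    pointwise w e = trans (sym (Vecₚ.tabulate∘lookup w)) (Vecₚ.tabulate-cong e)
    zero-off : ∀ w → ¬ Vec.lookup w ≗ p → Dec (inNC (Vec.lookup w) ≡ true) → u′ (Vec.lookup w) ≈ ε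
    zero-off w ne (yes e) = ≈-trans (reflexive (if-true e)) (h′ (NC-test⁻ (Vec.lookup w) e) ne)
    zero-off w ne (no ¬e) = reflexive (if-false ¬e)

  -- Row `p` of the matrix is supported at `f p` and column `q` at `g q`, so both iterated sums
  -- collapse to single entries.
  NC-reindex : (f g : Partition n → Partition n) (h : Partition n → Carrier) →
    (∀ {p} → Valid p → Valid (f p)) → (∀ {p} → Valid p → Valid (g p)) →
    (∀ {p q} → p ≗ q → f p ≗ f q) → (∀ {p q} → p ≗ q → g p ≗ g q) →
    (∀ {p} → Valid p → f (g p) ≗ p) → (∀ {p} → Valid p → g (f p) ≗ p) →
    (∀ {p q} → p ≗ q → h p ≈ h q) → sum (NC n) (h ∘ f) ≈ sum (NC n) h
  NC-reindex {n} f g h vf vg f-cong g-cong fg gf h-cong = sum-double m NC-valid NC-valid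
    (λ {p} vp → ≈-trans
      (NC-single (vf vp) (m p)
        (λ _ e → ≈-trans (m-true (≐⁺ e)) (≈-trans (h-cong e) (≈-sym (m-true (≐-refl (f p))))))
        (λ _ ne → m-false (ne ∘ ≐⁻)))
      (m-true (≐-refl (f p))))
    (λ {q} vq → ≈-trans
      (NC-single (vg vq) (λ p → m p q)
        (λ _ e → ≈-trans (m-true (≐⁺ λ i → trans (sym (fg vq i)) (sym (f-cong e i))))
                         (≈-sym (m-true (≐⁺ λ i → sym (fg vq i)))))
        (λ {p} vp ne → m-false λ e → ne λ i → trans (sym (gf vp i)) (g-cong (λ j → sym (≐⁻ e j)) i)))
      (m-true (≐⁺ λ i → sym (fg vq i))))
    where
    m : Partition n → Partition n → Carrier
    m p q = if q ≐ f p then h q else ε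
    m-true : ∀ {p q} → q ≐ f p ≡ true → m p q ≈ h q
    m-true e = reflexive (if-true e)
    m-false : ∀ {p q} → q ≐ f p ≢ true → m p q ≈ ε
    m-false e = reflexive (if-false e)

  -- The maps need to be inverse to each other only between the points selected by `P` and those
  -- selected by `Q`.
  allFin-reindex : (f g : Fin n → Fin n) (P Q : Fin n → Bool) (h : Fin n → Carrier) →
    (∀ {i} → P i ≡ true → Q (f i) ≡ true × g (f i) ≡ i) → (∀ {j} → Q j ≡ true → P (g j) ≡ true × f (g j) ≡ j) →
    sum (allFin n) (λ i → if P i then h (f i) else ε) ≈ sum (allFin n) (λ j → if Q j then h j else ε)
  allFin-reindex {n} f g P Q h fP gQ = sum-double {P = λ _ → ⊤} {λ _ → ⊤} m
    (All.universal (λ _ → tt) (allFin n)) (All.universal (λ _ → tt) (allFin n))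
    (λ {i} _ → ≈-trans (allFin-single (f i) (m i) λ ne → reflexive (if-false λ e → ne (==⁻ (proj₁ (∧⁻ e))))) (row i))
    (λ {j} _ → ≈-trans (allFin-single (g j) (λ i → m i j) λ {i} ne → reflexive (if-false λ e →
        let j≡fi , Pi = ∧⁻ {j == f i} e in
        ne (trans (sym (proj₂ (fP Pi))) (cong g (sym (==⁻ j≡fi))))))
      (column j))
    where
    m : Fin n → Fin n → Carrier
    m i j = if (j == f i) ∧ P i then h j else ε
    row : ∀ i → m i (f i) ≈ (if P i then h (f i) else ε)
    row i with P i true?
    ... | yes e = reflexive (trans (if-true (∧⁺ (==⁺ {i = f i} refl) e)) (sym (if-true e)))
    ... | no ne = reflexive (trans (if-false (ne ∘ proj₂ ∘ ∧⁻ {f i == f i})) (sym (if-false ne)))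
    column : ∀ j → m (g j) j ≈ (if Q j then h j else ε)
    column j with Q j true?
    ... | yes e = let Pg , fg = gQ e in reflexive (trans (if-true (∧⁺ (==⁺ (sym fg)) Pg)) (sym (if-true e)))
    ... | no ne = reflexive (trans (if-false λ e → let j≡ , Pg = ∧⁻ {j == f (g j)} e in
                    ne (subst (λ l → Q l ≡ true) (sym (==⁻ j≡)) (proj₁ (fP Pg)))) (sym (if-false ne)))

-- Counting by sums of indicators

module Count = Sum ℕₚ.+-0-commutativeMonoid

length-sum : (xs : List X) → length xs ≡ Count.sum xs (λ _ → 1)
length-sum [] = refl
length-sum (x ∷ xs) = cong suc (length-sum xs)

indicator : Bool → ℕ
indicator b = if b then 1 else 0

countF-sum : (P : Fin n → Bool) → countF P ≡ Count.sum (allFin n) (λ i → indicator (P i))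
countF-sum {n} P = trans (length-sum (filterᵇ P (allFin n)))
  (Count.sum-filterᵇ P (allFin n) (λ e → sym (if-true e)) if-false)

countF-reindex : (f g : Fin n → Fin n) {P Q : Fin n → Bool} →
  (∀ {i} → P i ≡ true → Q (f i) ≡ true × g (f i) ≡ i) → (∀ {j} → Q j ≡ true → P (g j) ≡ true × f (g j) ≡ j) →
  countF P ≡ countF Q
countF-reindex f g {P} {Q} fP gQ =
  trans (countF-sum P) (trans (Count.allFin-reindex f g P Q (λ _ → 1) fP gQ) (sym (countF-sum Q)))

-- A bijection that matches classes need not carry minima to minima, so the minimum `i` is sent to
-- `q (f i)`, the representative of the class of `f i`.
blocks-transport : {p q : Partition n} {f : Perm n} → (∀ i → p (p i) ≡ p i) → (∀ i → q (q i) ≡ q i) → Inj f →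
  (∀ {i j} → p i ≡ p j → q (f i) ≡ q (f j)) → (∀ {i j} → q (f i) ≡ q (f j) → p i ≡ p j) → blocks p ≡ blocks q
blocks-transport {p = p} {q} {f} idem-p idem-q inj pq qp = countF-reindex (q ∘ f) (p ∘ inv f)
  (λ {i} e → ==⁺ (idem-q (f i)) , trans (qp (trans (cong q (f-inv (q (f i)))) (idem-q (f i)))) (==⁻ e))
  (λ {j} e → ==⁺ (idem-p (inv f j)) ,
    trans (pq (idem-p (inv f j))) (trans (cong q (f-inv j)) (==⁻ e)))
  where
  f-inv : ∀ j → f (inv f j) ≡ j
  f-inv = inv-inverseʳ inj

-- The hypothesis says that f conjugates σ to the inverse of τ.
cycles-conjugate : {σ τ f : Perm n} → Inj σ → Inj τ → Inj f → (∀ i → τ (f (σ i)) ≡ f i) → cycles σ ≡ cycles τ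
cycles-conjugate {σ = σ} {τ} {f} inj-σ inj-τ inj-f h = trans (cycles-orbit inj-σ) (trans
  (blocks-transport (orbit-idem inj-σ) (orbit-idem inj-τ) inj-f
    (λ e → orbit-≡ inj-τ (orb-sym inj-τ (image (orbit-≡⁻ inj-σ e))))
    (λ e → orbit-≡ inj-σ (orb-sym inj-σ (let k , e′ = orbit-≡⁻ inj-τ e in preimage k _ e′))))
  (sym (cycles-orbit inj-τ)))
  where
  image : ∀ {i j} → Orb σ i j → Orb τ (f j) (f i)
  image (zero , refl) = orb-refl
  image (suc k , refl) = orb-trans (1 , h _) (image (k , refl))
  preimage : ∀ k i {j} → iter τ k (f i) ≡ f j → Orb σ j i
  preimage zero i e = 0 , inj-f (sym e)
  -- `τ` runs against `σ`: one step of `τ` leads from `f i` to `f i′`, where `i′` is the preimage of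
  -- `i` under `σ`.
  preimage (suc k) i {j} e = from (surj inj-σ i)
    where
    from : ∃[ i′ ] σ i′ ≡ i → Orb σ j i
    from (i′ , refl) = orb-trans (preimage k i′ (trans shift e)) (orb-step i′)
      where
      shift : iter τ k (f i′) ≡ iter τ (suc k) (f (σ i′))
      shift = trans (cong (iter τ k) (sym (h i′))) (trans (sym (iter-+ τ k 1 (f (σ i′))))
        (cong (λ m → iter τ m (f (σ i′))) (ℕₚ.+-comm k 1)))
-- The Kreweras complement

agree : Bool → Bool → Bool
agree true y = y
agree false y = not y

agree⁻ : ∀ {x y} → agree x y ≡ true → x ≡ y
agree⁻ {true} h = sym h
agree⁻ {false} {false} h = refl

agree⁺ : ∀ {x y} → x ≡ y → agree x y ≡ true
agree⁺ {true} refl = refl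
agree⁺ {false} refl = refl

-- The point of the complement labelled `i` sits just after `i`, so the chord from `α b` to `b`
-- covers it from `α b` inclusive to `b` exclusive.
inside : Partition n → Fin n → Fin n → Bool
inside α b i = (α b ≤ᶠ i) ∧ (i <ᶠ b)

Inside : Partition n → Fin n → Fin n → Set
Inside α b i = α b Fin.≤ i × i Fin.< b

inside⁻ : ∀ {α : Partition n} {b i} → inside α b i ≡ true → Inside α b i
inside⁻ {α = α} {b} {i} h = ≤ᶠ⁻ {i = α b} {i} (proj₁ (∧⁻ {α b ≤ᶠ i} h)) , <ᶠ⁻ {i = i} {b} (proj₂ (∧⁻ {α b ≤ᶠ i} h))

inside⁺ : ∀ {α : Partition n} {b i} → Inside α b i → inside α b i ≡ true
inside⁺ {α = α} {b} {i} (p , q) = ∧⁺ (≤ᶠ⁺ {i = α b} {i} p) (<ᶠ⁺ {i = i} {b} q)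

unseparated : Partition n → Fin n → Fin n → Bool
unseparated α i j = allF λ b → agree (inside α b i) (inside α b j)

Unseparated : Partition n → Fin n → Fin n → Set
Unseparated α i j = ∀ b → (Inside α b i → Inside α b j) × (Inside α b j → Inside α b i)

-- The point i of the complement sits between i and i + 1, and the chords joining each b to the
-- minimum of its block cut the disc into the regions that are the blocks of the complement.
kreweras : Partition n → Partition n
kreweras α = ker (unseparated α)

kreweras-cong : {α β : Partition n} → α ≗ β → kreweras α ≗ kreweras β
kreweras-cong {n} {α} {β} h i = minSat-cong
  (λ j → cong and (Listₚ.map-cong (λ b → cong₂ agree (cut b i) (cut b j)) (allFin n))) refl
  where
  cut : ∀ b i → inside α b i ≡ inside β b i
  cut b i = cong (λ m → (m ≤ᶠ i) ∧ (i <ᶠ b)) (h b)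

module _ (α : Partition n) where
  unseparated⁻ : ∀ {i j} → unseparated α i j ≡ true → Unseparated α i j
  unseparated⁻ {i} {j} h b =
    (λ p → inside⁻ {α = α} {b} {j} (trans (sym eq) (inside⁺ {α = α} {b} {i} p))) ,
    (λ p → inside⁻ {α = α} {b} {i} (trans eq (inside⁺ {α = α} {b} {j} p)))
    where
    eq : inside α b i ≡ inside α b j
    eq = agree⁻ (allF⁻ (λ b → agree (inside α b i) (inside α b j)) h b)

  unseparated⁺ : ∀ {i j} → Unseparated α i j → unseparated α i j ≡ true
  unseparated⁺ {i} {j} h = allF⁺ {P = λ b → agree (inside α b i) (inside α b j)} λ b → agree⁺ (true-ext
    (λ e → inside⁺ {α = α} {b} {j} (proj₁ (h b) (inside⁻ {α = α} {b} {i} e)))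
    (λ e → inside⁺ {α = α} {b} {i} (proj₂ (h b) (inside⁻ {α = α} {b} {j} e))))

  unseparated-equiv : Equiv (unseparated α)
  unseparated-equiv = record
    { rfl = λ i → unseparated⁺ {i} {i} λ b → id , id
    ; symm = λ {i} {j} h → unseparated⁺ {j} {i} λ b → let p , q = unseparated⁻ {i} {j} h b in q , p
    ; tran = λ {i} {j} {l} h h′ → unseparated⁺ {i} {l} λ b →
        let p , q = unseparated⁻ {i} {j} h b; p′ , q′ = unseparated⁻ {j} {l} h′ b in p′ ∘ p , q ∘ q′ }

  private module K = Kernel unseparated-equiv

  kreweras-rel : ∀ i → Unseparated α i (kreweras α i)
  kreweras-rel i = unseparated⁻ (K.ker-rel i)

  kreweras-≡ : ∀ {i j} → Unseparated α i j → kreweras α i ≡ kreweras α j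
  kreweras-≡ h = K.ker-≡ (unseparated⁺ h)

  kreweras-≡⁻ : ∀ {i j} → kreweras α i ≡ kreweras α j → Unseparated α i j
  kreweras-≡⁻ e = unseparated⁻ (K.ker-≡⁻ e)

  -- Each chord covers an interval. If it covers `a`, it covers `c` and hence `b`; if it covers `b`,
  -- it covers `d`, hence `c`, hence `a`.
  kreweras-valid : Valid (kreweras α)
  kreweras-valid = K.ker-valid λ {a} {b} {c} {d} a<b b<c c<d ac bd → unseparated⁺ {a} {b} λ x →
    let ac⇒ , ca⇒ = unseparated⁻ {a} {c} ac x; bd⇒ , db⇒ = unseparated⁻ {b} {d} bd x in
    (λ (p , q) → ℕₚ.≤-trans p (ℕₚ.<⇒≤ a<b) , ℕₚ.<-trans b<c (proj₂ (ac⇒ (p , q)))) ,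
    (λ (p , q) → ca⇒ (ℕₚ.≤-trans p (ℕₚ.<⇒≤ b<c) , ℕₚ.<-trans c<d (proj₂ (bd⇒ (p , q)))))

  kreweras-min : ∀ {i j} → Unseparated α i j → (∀ {x} → Unseparated α i x → j Fin.≤ x) → kreweras α i ≡ j
  kreweras-min {i} {j} h m = minSat-unique (unseparated α i) i (unseparated⁺ {i} {j} h)
    λ x h′ → m (unseparated⁻ {i} {x} h′)

top-≤ : (i j : Fin n) → top i Fin.≤ j
top-≤ i j = least top-valid {i} {j} (top-same i j)

module _ {α : Partition n} (v : Valid α) where
  -- Here `s` is the image of `i` under the long cycle and `j` its preimage under `perm α`. The
  -- identity of indicators is the local form of the count of blocks: summed over all `i`, it gives
  -- the global one.
  data Corner (i j s : Fin n) : Set where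
    corner : Next (kreweras α) i j →
      indicator (kreweras α j == j) + indicator (α s == s) ≡ 1 + indicator (top s == s) → Corner i j s

  private
    K : Partition n
    K = kreweras α

    -- In both wrapping cases s is the minimum and j the maximum of a block.
    block-of-max : ∀ {s j b} → s ≡ α j → s Fin.≤ α b → α b Fin.≤ j → j Fin.< b → α b ≡ α j
    block-of-max {s} {j} {b} s≡αj s≤αb αb≤j j<b with ℕₚ.m≤n⇒m<n∨m≡n s≤αb | ℕₚ.m≤n⇒m<n∨m≡n αb≤j
    ... | inj₂ s≡αb | _ = trans (sym (Finₚ.toℕ-injective s≡αb)) s≡αj
    ... | inj₁ s<αb | inj₂ αb≡j = trans (sym (idem v b)) (cong α (Finₚ.toℕ-injective αb≡j))
    ... | inj₁ s<αb | inj₁ αb<j = trans (sym (idem v b)) (trans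
      (sym (nc v s<αb αb<j j<b (trans (cong α s≡αj) (idem v j)) (idem v b))) (trans (cong α s≡αj) (idem v j)))

    indicators : ∀ {b c d : Bool} {x y z : ℕ} → indicator b ≡ x → indicator c ≡ y → indicator d ≡ z →
      x + y ≡ 1 + z → indicator b + indicator c ≡ 1 + indicator d
    indicators refl refl refl e = e

    is : ∀ {i j : Fin n} → i ≡ j → indicator (i == j) ≡ 1
    is e = if-true (==⁺ e)

    isn′t : ∀ {i j : Fin n} → i ≢ j → indicator (i == j) ≡ 0
    isn′t e = if-false (e ∘ ==⁻)

    <⇒top≢ : ∀ {i s : Fin n} → i Fin.< s → top s ≢ s
    <⇒top≢ {i} {s} i<s e = ℕₚ.<⇒≱ i<s (subst (Fin._≤ i) e (top-≤ s i))

    min-wrap : ∀ {i j} → Unseparated α i j → (∀ {x} → Unseparated α i x → j Fin.≤ x) →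
      (∀ {x} → Unseparated α i x → x Fin.≤ i) → Next K i j × K j ≡ j
    min-wrap {i} {j} h min max = wrap (sym Ki≡j) (λ e → max (kreweras-≡⁻ α (sym e))) ,
      trans (sym (kreweras-≡ α h)) Ki≡j
      where
      Ki≡j : K i ≡ j
      Ki≡j = kreweras-min α h min

  -- Going around the corner at i: along a block of α from j to s = i + 1, and along a block of K from i to j.
  corner-at : ∀ {i j s} → Next α j s → Next top i s → Corner i j s
  -- The chord of `s` covers `i` but nothing from `s` on, so `i` is the maximum of its block of `K`.
  -- The chord of `j` would separate a smaller point from `j`, so `j` is the minimum. Of the two
  -- indicators, that of `K` counts.
  corner-at {i} {j} {s} (step j<s αs≡αj after-j) (step i<s _ after-i) =
    corner (proj₁ Kmin) (indicators (is (proj₂ Kmin)) (isn′t αs≢s) (isn′t (<⇒top≢ {i} {s} i<s)) refl)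
    where
    below-s : ∀ {k} → k Fin.< s → k Fin.≤ i
    below-s k<s = ℕₚ.≮⇒≥ λ i<k → ℕₚ.<⇒≱ k<s (after-i i<k (top-same _ i))
    j≤i : j Fin.≤ i
    j≤i = below-s j<s
    αs≤j : α s Fin.≤ j
    αs≤j = least v αs≡αj
    αs≢s : α s ≢ s
    αs≢s e = ℕₚ.<⇒≱ j<s (subst (Fin._≤ j) e αs≤j)
    i⇒j : ∀ b → Inside α b i → Inside α b j
    i⇒j b (αb≤i , i<b) with ℕₚ.m≤n⇒m<n∨m≡n (after-i i<b (top-same b i))
    ... | inj₂ s≡b with refl ← Finₚ.toℕ-injective s≡b = αs≤j , j<s
    ... | inj₁ s<b = ℕₚ.≮⇒≥ (λ j<αb → ℕₚ.<⇒≱ j<αb (subst (Fin._≤ j)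
        (trans (nc v j<αb (ℕₚ.≤-<-trans αb≤i i<s) s<b (sym αs≡αj) (idem v b)) (idem v b)) (dec v j))) ,
      ℕₚ.<-trans j<s s<b
    j⇒i : ∀ b → Inside α b j → Inside α b i
    j⇒i b (αb≤j , j<b) = ℕₚ.≤-trans αb≤j j≤i , ℕₚ.≰⇒> λ b≤i →
      let b<s = ℕₚ.≤-<-trans b≤i i<s in ℕₚ.<⇒≱ b<s (after-j j<b (αb≡αj b<s (ℕₚ.m≤n⇒m<n∨m≡n αb≤j)))
      where
      αb≡αj : b Fin.< s → α b Fin.< j ⊎ toℕ (α b) ≡ toℕ j → α b ≡ α j
      αb≡αj b<s (inj₁ αb<j) = trans (sym (idem v b)) (nc v αb<j j<b b<s (idem v b) (sym αs≡αj))
      αb≡αj b<s (inj₂ αb≡j) = trans (sym (idem v b)) (cong α (Finₚ.toℕ-injective αb≡j))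
    Kmin : Next K i j × K j ≡ j
    Kmin = min-wrap (λ b → i⇒j b , j⇒i b)
      (λ {x} h → ℕₚ.≮⇒≥ λ x<j → ℕₚ.<⇒≱ (proj₂ (proj₂ (h j)
        (subst (Fin._≤ x) αs≡αj (proj₁ (proj₁ (h s) (ℕₚ.≤-trans αs≤j j≤i , i<s))) , x<j))) j≤i)
      (λ h → below-s (proj₂ (proj₁ (h s) (ℕₚ.≤-trans αs≤j j≤i , i<s))))
  -- A block of `α` runs from `s` to `j`. Its widest chord covers all of `s` up to `j` exclusive and
  -- neither `i` nor `j`, so `i` and `j` are consecutive in their block of `K`. Here the indicator
  -- of `α` counts.
  corner-at {i} {j} {s} (wrap s≡αj max-j) (step i<s _ after-i) =
    corner (step i<j (kreweras-≡ α (λ b → j⇒i b , i⇒j b)) after)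
      (indicators (isn′t Kj≢j) (is (sym s≡αs)) (isn′t (<⇒top≢ {i} {s} i<s)) refl)
    where
    s≡αs : s ≡ α s
    s≡αs = trans s≡αj (sym (trans (cong α s≡αj) (idem v j)))
    s≤j : s Fin.≤ j
    s≤j = subst (Fin._≤ j) (sym s≡αj) (dec v j)
    i<j : i Fin.< j
    i<j = ℕₚ.<-≤-trans i<s s≤j
    αb≢s : ∀ {b} → α b Fin.≤ i → α b ≢ s
    αb≢s αb≤i e = ℕₚ.<⇒≱ i<s (subst (Fin._≤ i) e αb≤i)
    i⇒j : ∀ b → Inside α b i → Inside α b j
    i⇒j b (αb≤i , i<b) = ℕₚ.≤-trans αb≤i (ℕₚ.<⇒≤ i<j) , ℕₚ.≰⇒> λ b≤j →
      αb≢s αb≤i (αb≡s (ℕₚ.m≤n⇒m<n∨m≡n (after-i i<b (top-same b i))) (ℕₚ.m≤n⇒m<n∨m≡n b≤j))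
      where
      αb≡s : s Fin.< b ⊎ toℕ s ≡ toℕ b → b Fin.< j ⊎ toℕ b ≡ toℕ j → α b ≡ s
      αb≡s (inj₂ s≡b) _ = trans (cong α (sym (Finₚ.toℕ-injective s≡b))) (sym s≡αs)
      αb≡s (inj₁ s<b) (inj₂ b≡j) = trans (cong α (Finₚ.toℕ-injective b≡j)) (sym s≡αj)
      αb≡s (inj₁ s<b) (inj₁ b<j) = trans (sym (idem v b)) (trans
        (nc v (ℕₚ.≤-<-trans αb≤i i<s) s<b b<j (idem v b) (trans (sym s≡αs) s≡αj)) (sym s≡αs))
    j⇒i : ∀ b → Inside α b j → Inside α b i
    j⇒i b (αb≤j , j<b) = ℕₚ.≮⇒≥ (λ i<αb → ℕₚ.<⇒≱ j<b
        (max-j (block-of-max s≡αj (after-i i<αb (top-same (α b) i)) αb≤j j<b))) ,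
      ℕₚ.<-trans i<j j<b
    after : ∀ {k} → i Fin.< k → K k ≡ K i → j Fin.≤ k
    after {k} i<k e = ℕₚ.≮⇒≥ λ k<j → ℕₚ.<⇒≱ i<s (subst (Fin._≤ i) (sym s≡αj)
      (proj₁ (proj₁ (kreweras-≡⁻ α e j) (subst (Fin._≤ k) s≡αj (after-i i<k (top-same k i)) , k<j))))
    Kj≢j : K j ≢ j
    Kj≢j e = ℕₚ.<⇒≱ i<j (subst (Fin._≤ i) (trans (kreweras-≡ α (λ b → i⇒j b , j⇒i b)) e)
      (dec (kreweras-valid α) i))
  -- Now `i` is the last point and `s` the first. No chord covers `i` or `j`, so both lie in the
  -- outer region, which starts at `j`. Both indicators count, and so does that of `top`.
  corner-at {i} {j} {s} (wrap s≡αj max-j) (wrap s≡top max-i) =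
    corner (proj₁ Kmin) (indicators (is (proj₂ Kmin)) (is (sym s≡αs)) (is top-s) refl)
    where
    s≡αs : s ≡ α s
    s≡αs = trans s≡αj (sym (trans (cong α s≡αj) (idem v j)))
    s≤ : ∀ k → s Fin.≤ k
    s≤ k = subst (Fin._≤ k) (sym s≡top) (top-≤ i k)
    top-s : top s ≡ s
    top-s = trans (cong top s≡top) (trans (idem top-valid i) (sym s≡top))
    Kmin : Next K i j × K j ≡ j
    Kmin = min-wrap
      (λ b → (λ (_ , i<b) → contradiction (max-i (top-same b i)) (ℕₚ.<⇒≱ i<b)) ,
             (λ (αb≤j , j<b) → contradiction (max-j (block-of-max s≡αj (s≤ (α b)) αb≤j j<b)) (ℕₚ.<⇒≱ j<b)))
      (λ {x} h → ℕₚ.≮⇒≥ λ x<j → ℕₚ.<⇒≱ (proj₂ (proj₂ (h j) (subst (Fin._≤ x) s≡αj (s≤ x) , x<j)))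
        (max-i (top-same j i)))
      (λ {x} _ → max-i (top-same x i))
  -- After the wrap `s` is the least point of all, so no `j` lies below it.
  corner-at {i} {j} {s} (step j<s _ _) (wrap s≡top _) =
    contradiction (subst (Fin._≤ j) (sym s≡top) (top-≤ i j)) (ℕₚ.<⇒≱ j<s)

  corner-exists : ∀ i → ∃[ j ] perm α j ≡ perm top i × Corner i j (perm top i)
  corner-exists i = j , αj≡s , corner-at (subst (Next α j) αj≡s (next-perm α j)) (next-perm top i)
    where
    j = inv (perm α) (perm top i)
    αj≡s : perm α j ≡ perm top i
    αj≡s = inv-inverseʳ (perm-inj v) (perm top i)

  perm-kreweras : ∀ i → perm α (perm (kreweras α) i) ≡ perm top i
  perm-kreweras i with j , αj≡s , corner next _ ← corner-exists i =
    trans (cong (perm α) (next-unique K next)) αj≡s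

  corner-count : ∀ i → indicator (kreweras α (perm (kreweras α) i) == perm (kreweras α) i) +
    indicator (α (perm top i) == perm top i) ≡ 1 + indicator (top (perm top i) == perm top i)
  corner-count i with j , _ , corner next e ← corner-exists i =
    subst (λ l → indicator (kreweras α l == l) + indicator (α (perm top i) == perm top i)
                 ≡ 1 + indicator (top (perm top i) == perm top i)) (sym (next-unique K next)) e

  inv-perm-top : ∀ i → inv (perm α) (perm top i) ≡ perm (kreweras α) i
  inv-perm-top i = inv-unique (perm-inj v) (perm-kreweras i)

-- Block count and distances under the complement

countF-perm : {σ : Perm n} → Inj σ → (P : Fin n → Bool) → countF (P ∘ σ) ≡ countF P
countF-perm {σ = σ} inj P = countF-reindex σ (inv σ)
  (λ e → e , inv-inverseˡ inj _)
  (λ {j} e → trans (cong P (inv-inverseʳ inj j)) e , inv-inverseʳ inj j)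

blocks-top : blocks {suc n} top ≡ 1
blocks-top {n} = trans (countF-sum {suc n} (λ i → top {suc n} i == i)) (trans
  (Count.allFin-single {suc n} (top zero) (λ i → indicator (top i == i))
    λ {j} ne → if-false λ e → ne (trans (sym (==⁻ e)) (top-same j zero)))
  (if-true {x = 1} {0} (==⁺ (idem (top-valid {suc n}) zero))))

-- The corner identities are summed over `i`. Since `perm K` and `perm top` only permute the
-- summation index, the sums count the block minima of `K`, of `α` and of `top`, the last being a
-- single one.
blocks-kreweras : {α : Partition (suc n)} → Valid α → blocks (kreweras α) + blocks α ≡ suc n + 1
blocks-kreweras {n} {α} v = begin
  blocks K + blocks α
    ≡⟨ cong₂ _+_ (sym (countF-perm {σ = perm K} (perm-inj (kreweras-valid α)) (λ i → K i == i)))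
                 (sym (countF-perm {σ = perm top} (perm-inj top-valid) (λ i → α i == i))) ⟩
  countF PK + countF Pα
    ≡⟨ cong₂ _+_ (countF-sum PK) (countF-sum Pα) ⟩
  Count.sum I (indicator ∘ PK) + Count.sum I (indicator ∘ Pα)
    ≡⟨ sym (Count.sum-∙ I (indicator ∘ PK) (indicator ∘ Pα)) ⟩
  Count.sum I (λ i → indicator (PK i) + indicator (Pα i))
    ≡⟨ Count.sum-cong I (corner-count v) ⟩
  Count.sum I (λ i → 1 + indicator (Pt i))
    ≡⟨ Count.sum-∙ I (λ _ → 1) (indicator ∘ Pt) ⟩
  Count.sum I (λ _ → 1) + Count.sum I (indicator ∘ Pt)
    ≡⟨ cong₂ _+_ (trans (sym (length-sum I)) (Listₚ.length-tabulate id)) (trans (sym (countF-sum Pt))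
         (trans (countF-perm {suc n} {perm top} (perm-inj top-valid) (λ i → top {suc n} i == i)) (blocks-top {n}))) ⟩
  suc n + 1 ∎
  where
  open ≡-Reasoning
  K : Partition (suc n)
  K = kreweras α
  I : List (Fin (suc n))
  I = allFin (suc n)
  PK Pα Pt : Fin (suc n) → Bool
  PK i = K (perm K i) == perm K i
  Pα i = α (perm top i) == perm top i
  Pt i = top (perm top i) == perm top i

norm-kreweras : {α : Partition n} → Valid α → ∥ kreweras α ∥ₚ ≡ n ∸ 1 ∸ ∥ α ∥ₚ
-- The block count does not extend to the empty set, where `top` has no block; there truncated
-- subtraction makes both sides zero.
norm-kreweras {zero} {α} v = trans (ℕₚ.0∸n≡0 (cycles (perm (kreweras α)))) (sym (ℕₚ.0∸n≡0 ∥ α ∥ₚ))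
norm-kreweras {suc n} {α} v = arithmetic (cycles (perm (kreweras α))) (cycles (perm α))
  (cycles≤n (perm (kreweras α))) (cycles≤n (perm α))
  (trans (cong₂ _+_ (cycles-perm (kreweras-valid α)) (cycles-perm v)) (blocks-kreweras v))
  where
  arithmetic : ∀ x y → x ≤ suc n → y ≤ suc n → x + y ≡ suc n + 1 → suc n ∸ x ≡ n ∸ (suc n ∸ y)
  -- With `y` zero the sum would push `x` above `suc n`; excluding this keeps the truncated
  -- subtractions exact.
  arithmetic x zero x≤ y≤ e = contradiction
    (subst (_≤ suc n) (trans (sym (ℕₚ.+-identityʳ x)) (trans e (ℕₚ.+-comm (suc n) 1))) x≤) ℕₚ.1+n≰n
  arithmetic x (suc y) x≤ (s≤s y≤n) e = trans (cong (_∸ x) (sym x+y)) (trans (ℕₚ.m+n∸m≡n x y)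
    (sym (ℕₚ.m∸[m∸n]≡n y≤n)))
    where
    x+y : x + y ≡ suc n
    x+y = ℕₚ.suc-injective (trans (sym (ℕₚ.+-suc x y)) (trans e (ℕₚ.+-comm (suc n) 1)))

-- The quotient of the long cycle by `perm α` is the permutation of the complement.
dist-top : {α : Partition n} → Valid α → dist α top ≡ n ∸ 1 ∸ ∥ α ∥ₚ
dist-top {n} {α} v = trans (cong (n ∸_) (cycles-cong (inv-perm-top v))) (norm-kreweras v)

-- Write `Kα` for the complement of `α`. Conjugating the quotient of `Kβ` by `Kα` with `perm Kα`
-- gives `perm Kβ` times the inverse of `perm Kα`. The long cycle cancels, which leaves the inverse
-- of the quotient of `perm β` by `perm α`, and an inverse has the same cycles.
dist-kreweras : {α β : Partition n} → Valid α → Valid β → dist (kreweras α) (kreweras β) ≡ dist α β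
dist-kreweras {n} {α} {β} vα vβ = cong (n ∸_) (cycles-conjugate {f = perm (kreweras α)}
  (perm-inj vKβ ∘ inv-inj (perm-inj vKα)) (perm-inj vβ ∘ inv-inj (perm-inj vα)) (perm-inj vKα)
  λ i → trans (cong (inv (perm α) ∘ perm β) (inv-inverseʳ (perm-inj vKα) (perm (kreweras β) i)))
    (trans (cong (inv (perm α)) (perm-kreweras vβ i)) (inv-perm-top vα i)))
  where
  vKα = kreweras-valid α
  vKβ = kreweras-valid β

-- The complement as an order-reversing bijection

kreweras-antitone : {α γ : Partition n} → Valid γ → α ⊑ γ → kreweras γ ⊑ kreweras α
kreweras-antitone {n} {α} {γ} vγ α⊑γ i = sym (kreweras-≡ α λ b →
  half b (kreweras-rel γ i) , half b (λ c → let p , q = kreweras-rel γ i c in q , p))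
  where
  -- The chord of `b` in `α` covers what the chord of `b` in `γ` covers and the chord of `α b` in
  -- `γ` does not, as both of the latter start at `γ b`.
  half : ∀ b {i j} → Unseparated γ i j → Inside α b i → Inside α b j
  half b {i} {j} h (αb≤i , i<b) =
    let γb≤αb = subst (Fin._≤ α b) (α⊑γ b) (dec vγ (α b))
        γb≤j , j<b = proj₁ (h b) (ℕₚ.≤-trans γb≤αb αb≤i , i<b)
    in ℕₚ.≮⇒≥ (λ j<αb → ℕₚ.<⇒≱ (proj₂ (proj₂ (h (α b)) (subst (Fin._≤ j) (sym (α⊑γ b)) γb≤j , j<αb))) αb≤i) , j<b

-- All chords start at the least point, and the chord of `j` covers every earlier point but not `j`
-- itself.
kreweras-top : kreweras {n} top ≗ bot
kreweras-top i = sym (only i (kreweras top i) (kreweras-rel top i))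
  where
  only : ∀ i j → Unseparated top i j → i ≡ j
  only i j h with Finₚ.<-cmp i j
  ... | tri< i<j _ _ = contradiction (proj₂ (proj₁ (h j) (top-≤ j i , i<j))) (ℕₚ.<-irrefl refl)
  ... | tri≈ _ i≡j _ = i≡j
  ... | tri> _ _ j<i = contradiction (proj₂ (proj₂ (h i) (top-≤ i j , j<i))) (ℕₚ.<-irrefl refl)

-- The square is iterated because it preserves the order and acts as conjugation by the long cycle.
kreweras² : ℕ → Partition n → Partition n
kreweras² zero α = α
kreweras² (suc m) α = kreweras (kreweras (kreweras² m α))

kreweras²-valid : {α : Partition n} → ∀ m → Valid α → Valid (kreweras² m α)
kreweras²-valid zero v = v
kreweras²-valid {α = α} (suc m) v = kreweras-valid (kreweras (kreweras² m α))

kreweras²-cong : {α β : Partition n} → ∀ m → α ≗ β → kreweras² m α ≗ kreweras² m β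
kreweras²-cong zero h = h
kreweras²-cong {α = α} {β} (suc m) h =
  kreweras-cong {α = kreweras (kreweras² m α)} {kreweras (kreweras² m β)}
    (kreweras-cong {α = kreweras² m α} {kreweras² m β} (kreweras²-cong m h))

kreweras²-mono : {α β : Partition n} → ∀ m → Valid α → Valid β → α ⊑ β → kreweras² m α ⊑ kreweras² m β
kreweras²-mono zero vα vβ h = h
kreweras²-mono {α = α} {β} (suc m) vα vβ h =
  kreweras-antitone {α = kreweras (kreweras² m β)} {kreweras (kreweras² m α)} (kreweras-valid (kreweras² m α))
    (kreweras-antitone {α = kreweras² m α} {kreweras² m β} (kreweras²-valid m vβ) (kreweras²-mono m vα vβ h))

kreweras²-comm : ∀ m (α : Partition n) → kreweras² m (kreweras α) ≡ kreweras (kreweras² m α)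
kreweras²-comm zero α = refl
kreweras²-comm (suc m) α = cong (kreweras ∘ kreweras) (kreweras²-comm m α)

-- The square of the complement is conjugation by the long cycle.
perm-kreweras² : {α : Partition n} → Valid α → ∀ m i →
  perm α (iter (perm top) m i) ≡ iter (perm top) m (perm (kreweras² m α) i)
perm-kreweras² v zero i = refl
perm-kreweras² {α = α} v (suc m) i = begin
  perm α (iter c (suc m) i)                  ≡⟨ cong (perm α) (rotate m i) ⟩
  perm α (iter c m (c i))                    ≡⟨ perm-kreweras² v m (c i) ⟩
  -- The long cycle is factored through `kreweras β` and its complement, then reassembled from `β`
  -- and `kreweras β`; thus `perm β` moves past it at the price of one square.
  iter c m (perm β (c i))                    ≡⟨ cong (iter c m ∘ perm β) (sym (perm-kreweras (kreweras-valid β) i)) ⟩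
  iter c m (perm β (perm (kreweras β) (perm (kreweras (kreweras β)) i)))
                                             ≡⟨ cong (iter c m) (perm-kreweras (kreweras²-valid m v) _) ⟩
  iter c m (c (perm (kreweras (kreweras β)) i)) ≡⟨ sym (rotate m _) ⟩
  iter c (suc m) (perm (kreweras (kreweras β)) i) ∎
  where
  open ≡-Reasoning
  c = perm top
  β = kreweras² m α
  rotate : ∀ m i → iter c (suc m) i ≡ iter c m (c i)
  rotate m i = trans (cong (λ l → iter c l i) (ℕₚ.+-comm 1 m)) (iter-+ c m 1 i)

-- Every point is an iterate of `zero`, so the return time of `zero` is a period for all points.
long-cycle-order : ∀ n → ∃[ k ] ∀ (i : Fin n) → iter (perm top) (suc k) i ≡ i
long-cycle-order zero = 0 , λ ()
long-cycle-order (suc n) with k , e ← iter-returns (perm-inj top-valid) (zero {n}) =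
  k , λ i → from-zero (orb-perm top-valid (top-same zero i))
  where
  c = perm (top {suc n})
  from-zero : ∀ {i} → Orb c zero i → iter c (suc k) i ≡ i
  from-zero (m , refl) = trans (sym (iter-+ c (suc k) m zero)) (trans (cong (λ l → iter c l zero) (ℕₚ.+-comm (suc k) m))
    (trans (iter-+ c m (suc k) zero) (cong (iter c m) e)))

private
  order : ℕ → ℕ
  order n = proj₁ (long-cycle-order n)

kreweras²-order : {α : Partition n} → Valid α → kreweras² (suc (order n)) α ≗ α
kreweras²-order {n} {α} v = perm-injective (kreweras²-valid N v) v λ i →
  trans (sym (proj₂ (long-cycle-order n) (perm (kreweras² N α) i)))
    (trans (sym (perm-kreweras² v N i)) (cong (perm α) (proj₂ (long-cycle-order n) i)))
  where N = suc (order n)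

-- With `N = suc (order n)` the complement applied `2N` times is the identity, and this is its power
-- with exponent `2N - 1`.
kreweras⁻¹ : Partition n → Partition n
kreweras⁻¹ {n} α = kreweras (kreweras² (order n) α)

kreweras⁻¹-valid : (α : Partition n) → Valid (kreweras⁻¹ α)
kreweras⁻¹-valid {n} α = kreweras-valid (kreweras² (order n) α)

kreweras⁻¹-cong : {α β : Partition n} → α ≗ β → kreweras⁻¹ α ≗ kreweras⁻¹ β
kreweras⁻¹-cong {n} {α} {β} h =
  kreweras-cong {α = kreweras² (order n) α} {kreweras² (order n) β} (kreweras²-cong (order n) h)

kreweras-inverseʳ : {α : Partition n} → Valid α → kreweras (kreweras⁻¹ α) ≗ α
kreweras-inverseʳ = kreweras²-order

kreweras-inverseˡ : {α : Partition n} → Valid α → kreweras⁻¹ (kreweras α) ≗ α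
kreweras-inverseˡ {n} {α} v = subst (λ p → kreweras p ≗ α) (sym (kreweras²-comm (order n) α)) (kreweras²-order v)

kreweras⁻¹-antitone : {α β : Partition n} → Valid α → Valid β → α ⊑ β → kreweras⁻¹ β ⊑ kreweras⁻¹ α
kreweras⁻¹-antitone {n} {α} {β} vα vβ h =
  kreweras-antitone {α = kreweras² (order n) α} {kreweras² (order n) β}
    (kreweras²-valid (order n) vβ) (kreweras²-mono (order n) vα vβ h)

module _ {α β : Partition n} (vα : Valid α) (vβ : Valid β) where
  private
    δ : Partition n
    δ = kreweras α ∧ₙ kreweras β
    vδ : Valid δ
    vδ = meet-valid (kreweras α) (kreweras β) (kreweras-valid α) (kreweras-valid β)

  -- The inverse complement of the meet `δ` lies above `α` and `β`, hence is `top`, and the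
  -- complement of `top` is `bot`.
  join-top⇒meet-bot : IsJoin α β top → (kreweras α ∧ₙ kreweras β) ≗ bot
  join-top⇒meet-bot J i = trans (sym (kreweras-inverseʳ vδ i))
    (trans (kreweras-cong {α = kreweras⁻¹ δ} {top} K⁻¹δ≗top i) (kreweras-top i))
    where
    K⁻¹δ≗top : kreweras⁻¹ δ ≗ top
    K⁻¹δ≗top = top-⊑ (kreweras⁻¹-valid δ) (minimal J (kreweras⁻¹-valid δ)
      (⊑-resp (kreweras-inverseˡ vα) (λ _ → refl)
        (kreweras⁻¹-antitone vδ (kreweras-valid α) (meet-⊑ˡ (kreweras α) (kreweras β))))
      (⊑-resp (kreweras-inverseˡ vβ) (λ _ → refl)
        (kreweras⁻¹-antitone vδ (kreweras-valid β) (meet-⊑ʳ (kreweras α) (kreweras β)))))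

  -- The complement of an upper bound `γ` lies below both complements, so it is `bot`, the
  -- complement of `top`; invertibility gives `γ ≗ top`.
  meet-bot⇒join-top : (kreweras α ∧ₙ kreweras β) ≗ bot → IsJoin α β top
  meet-bot⇒join-top δ≗bot = record
    { upperˡ = ⊑-top α
    ; upperʳ = ⊑-top β
    ; minimal = λ {γ} vγ α⊑γ β⊑γ → ≗⇒⊑ vγ λ i → trans
        (trans (sym (kreweras-inverseˡ top-valid i)) (kreweras⁻¹-cong {α = kreweras top} {kreweras γ}
          (λ j → trans (kreweras-top j) (sym (⊑-resp {γ = δ} {bot} (λ _ → refl) δ≗bot
            (meet-greatest (kreweras α) (kreweras β) (kreweras-antitone vγ α⊑γ) (kreweras-antitone vγ β⊑γ)) j))) i))
        (kreweras-inverseˡ vγ i) }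
-- Splitting off one block

AllPairs-lookup : ∀ {r} {R : X → X → Set r} {xs : List X} → AllPairs R xs →
  ∀ {x y : Fin (length xs)} → x Fin.< y → R (List.lookup xs x) (List.lookup xs y)
AllPairs-lookup (rs ∷ _) {zero} {suc y} _ = All.lookup rs (∈ₚ.∈-lookup y)
AllPairs-lookup (_ ∷ rs) {suc x} {suc y} (s≤s x<y) = AllPairs-lookup rs x<y

Separates : Partition n → Partition n → Set
Separates α β = ∀ {i j} → α i ≡ α j → β i ≡ β j → i ≡ j

meet-bot⁻ : {α β : Partition n} → (α ∧ₙ β) ≐ bot ≡ true → Separates α β
meet-bot⁻ {α = α} {β} h {i} {j} p q = trans (sym (e i)) (trans (meet-same α β p q) (e j))
  where
  e : (α ∧ₙ β) ≗ bot
  e = ≐⁻ {p = α ∧ₙ β} {bot} h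

meet-bot⁺ : {α β : Partition n} → Separates α β → (α ∧ₙ β) ≐ bot ≡ true
meet-bot⁺ {α = α} {β} s = ≐⁺ {p = α ∧ₙ β} {bot} λ i → s (meet-⊑ˡ α β i) (meet-⊑ʳ α β i)

module Members {n} (C : Fin n → Bool) where
  members : List (Fin n)
  members = filterᵇ C (allFin n)

  ι : Fin (countF C) → Fin n
  ι = List.lookup members

  ι-mono-< : ∀ {x y} → x Fin.< y → ι x Fin.< ι y
  ι-mono-< = AllPairs-lookup (AllPairsₚ.filter⁺ (Boolₚ.T? ∘ C) (allFin-sorted n))

  ι-in : ∀ x → C (ι x) ≡ true
  ι-in x = proj₂ (∈-filterᵇ⁻ C (allFin n) (∈ₚ.∈-lookup x))

  ι-cover : ∀ {i} → C i ≡ true → ∃[ x ] i ≡ ι x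
  ι-cover {i} h = Any.index i∈ , Anyₚ.lookup-index i∈
    where
    i∈ : i ∈ members
    i∈ = ∈-filterᵇ⁺ C (∈ₚ.∈-allFin i) h

  ι-mono-≤ : ∀ {x y} → x Fin.≤ y → ι x Fin.≤ ι y
  ι-mono-≤ x≤y with ℕₚ.m≤n⇒m<n∨m≡n x≤y
  ... | inj₁ x<y = ℕₚ.<⇒≤ (ι-mono-< x<y)
  ... | inj₂ x≡y with refl ← Finₚ.toℕ-injective x≡y = ℕₚ.≤-refl

  ι-cancel-< : ∀ {x y} → ι x Fin.< ι y → x Fin.< y
  ι-cancel-< h = ℕₚ.≰⇒> λ y≤x → ℕₚ.<⇒≱ h (ι-mono-≤ y≤x)

  ι-cancel-≤ : ∀ {x y} → ι x Fin.≤ ι y → x Fin.≤ y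
  ι-cancel-≤ h = ℕₚ.≮⇒≥ λ y<x → ℕₚ.<⇒≱ (ι-mono-< y<x) h

  ι-inj : ∀ {x y} → ι x ≡ ι y → x ≡ y
  ι-inj e = Finₚ.≤-antisym (ι-cancel-≤ (ℕₚ.≤-reflexive (cong toℕ e))) (ι-cancel-≤ (ℕₚ.≤-reflexive (cong toℕ (sym e))))

  data View : Fin n → Set where
    inn : ∀ x → View (ι x)
    out : ∀ {i} → C i ≢ true → View i

  view : ∀ i → View i
  view i with C i true?
  ... | no ne = out ne
  ... | yes e with x , refl ← ι-cover e = inn x

  -- Every point of `C` satisfies `P₂`, so the right side counts all of `C` in addition to `P`; the
  -- summand `countF C` on the left balances this.
  countF-split : {P P₂ : Fin n → Bool} {P₁ : Fin (countF C) → Bool} → (∀ x → P (ι x) ≡ P₁ x) →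
    (∀ {i} → C i ≢ true → P i ≡ P₂ i) → (∀ x → P₂ (ι x) ≡ true) → countF P + countF C ≡ countF P₁ + countF P₂
  countF-split {P} {P₂} {P₁} on off fixed = begin
    countF P + countF C
      ≡⟨ cong₂ _+_ (countF-sum P) (countF-sum C) ⟩
    Count.sum I (indicator ∘ P) + Count.sum I (indicator ∘ C)
      ≡⟨ sym (Count.sum-∙ I (indicator ∘ P) (indicator ∘ C)) ⟩
    Count.sum I (λ i → indicator (P i) + indicator (C i))
      ≡⟨ Count.sum-cong I (λ i → pointwise (view i)) ⟩
    Count.sum I (λ i → PC i + indicator (P₂ i))
      ≡⟨ Count.sum-∙ I PC (indicator ∘ P₂) ⟩
    Count.sum I PC + Count.sum I (indicator ∘ P₂)
      ≡⟨ cong₂ _+_ (sym (Count.sum-filterᵇ C I (λ e → sym (if-true e)) if-false)) (sym (countF-sum P₂)) ⟩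
    Count.sum members (indicator ∘ P) + countF P₂
      ≡⟨ cong (_+ countF P₂) (trans (Count.sum-lookup members (indicator ∘ P))
           (trans (Count.sum-cong (allFin (countF C)) (λ x → cong indicator (on x))) (sym (countF-sum P₁)))) ⟩
    countF P₁ + countF P₂ ∎
    where
    open ≡-Reasoning
    I : List (Fin n)
    I = allFin n
    PC : Fin n → ℕ
    PC i = if C i then indicator (P i) else 0
    pointwise : ∀ {i} → View i → indicator (P i) + indicator (C i) ≡ PC i + indicator (P₂ i)
    pointwise (inn x) = cong₂ _+_ (sym (if-true (ι-in x))) (trans (if-true (ι-in x)) (sym (if-true (fixed x))))
    pointwise {i} (out ne) = trans (cong₂ _+_ (cong indicator (off ne)) (if-false ne))
      (trans (ℕₚ.+-identityʳ _) (cong (_+ indicator (P₂ i)) (sym (if-false ne))))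

  -- f₂ fixes C instead of living on a smaller type, so that removing a block does not relabel the points.
  record Split (f : Fin n → Fin n) (f₁ : Fin (countF C) → Fin (countF C)) (f₂ : Fin n → Fin n) : Set where
    field
      on : ∀ x → f (ι x) ≡ ι (f₁ x)
      off : ∀ {i} → C i ≢ true → f i ≡ f₂ i
      off-closed : ∀ {i} → C i ≢ true → C (f i) ≢ true
      fixed : ∀ x → f₂ (ι x) ≡ ι x

    off-closed₂ : ∀ {i} → C i ≢ true → C (f₂ i) ≢ true
    off-closed₂ ne = subst (λ j → C j ≢ true) (off ne) (off-closed ne)

    on≢off : ∀ {x i} → C i ≢ true → f (ι x) ≢ f i
    on≢off {x} ne e = off-closed ne (trans (cong C (trans (sym e) (on x))) (ι-in (f₁ x)))

    on≢off₂ : ∀ {x i} → C i ≢ true → f₂ (ι x) ≢ f₂ i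
    on≢off₂ {x} ne e = off-closed₂ ne (trans (cong C (trans (sym e) (fixed x))) (ι-in x))

    on-inj : ∀ {x y} → f (ι x) ≡ f (ι y) → f₁ x ≡ f₁ y
    on-inj e = ι-inj (trans (sym (on _)) (trans e (on _)))
  open Split

  iter-split : ∀ {f f₁ f₂} → Split f f₁ f₂ → ∀ m → Split (iter f m) (iter f₁ m) (iter f₂ m)
  iter-split s zero = record { on = λ _ → refl ; off = λ _ → refl ; off-closed = id ; fixed = λ _ → refl }
  iter-split {f} {f₁} {f₂} s (suc m) = record
    { on = λ x → trans (cong f (on t x)) (on s _)
    ; off = λ ne → trans (off s (off-closed t ne)) (cong f₂ (off t ne))
    ; off-closed = λ ne → off-closed s (off-closed t ne)
    ; fixed = λ x → trans (cong f₂ (fixed t x)) (fixed s x) }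
    where
    t : Split (iter f m) (iter f₁ m) (iter f₂ m)
    t = iter-split s m

  comp-split : ∀ {f f₁ f₂ g g₁ g₂} → Split f f₁ f₂ → Split g g₁ g₂ → Split (f · g) (f₁ · g₁) (f₂ · g₂)
  comp-split {f} {f₁} {f₂} s t = record
    { on = λ x → trans (cong f (on t x)) (on s _)
    ; off = λ ne → trans (off s (off-closed t ne)) (cong f₂ (off t ne))
    ; off-closed = λ ne → off-closed s (off-closed t ne)
    ; fixed = λ x → trans (cong f₂ (fixed t x)) (fixed s x) }

  inv-split : ∀ {f f₁ f₂} → Inj f → Inj f₁ → Inj f₂ → Split f f₁ f₂ → Split (inv f) (inv f₁) (inv f₂)
  inv-split {f} {f₁} {f₂} h h₁ h₂ s = record
    { on = λ x → inv-unique h (trans (on s _) (cong ι (inv-inverseʳ h₁ x)))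
    ; off = λ {i} ne → inv-unique h (trans (off s (preimage-off i ne (view (inv f₂ i)) refl)) (inv-inverseʳ h₂ i))
    ; off-closed = λ {i} ne e → let x , e′ = ι-cover e in
        ne (trans (cong C (trans (sym (inv-inverseʳ h i)) (trans (cong f e′) (on s x)))) (ι-in (f₁ x)))
    ; fixed = λ x → inv-unique h₂ (fixed s x) }
    where
    preimage-off : ∀ i → C i ≢ true → ∀ {j} → View j → j ≡ inv f₂ i → C (inv f₂ i) ≢ true
    preimage-off i ne (out ne′) refl = ne′
    preimage-off i ne (inn x) e = contradiction
      (trans (cong C (trans (sym (inv-inverseʳ h₂ i)) (trans (cong f₂ (sym e)) (fixed s x)))) (ι-in x)) ne

  cycles-split : ∀ {f f₁ f₂} → Split f f₁ f₂ → cycles f + countF C ≡ cycles f₁ + cycles f₂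
  cycles-split {f} {f₁} {f₂} s = countF-split {cycleMin f} {cycleMin f₂} {cycleMin f₁}
    (λ x → true-ext
      (λ h → cycleMin⁺ f₁ {x} λ { (k , refl) →
        ι-cancel-≤ (subst (ι x Fin.≤_) (on (iter-split s k) x) (cycleMin⁻ f {ι x} h (k , refl))) })
      (λ h → cycleMin⁺ f {ι x} λ { (k , refl) →
        subst (ι x Fin.≤_) (sym (on (iter-split s k) x)) (ι-mono-≤ (cycleMin⁻ f₁ {x} h (k , refl))) }))
    (λ {i} ne → true-ext
      (λ h → cycleMin⁺ f₂ {i} λ { (k , refl) → cycleMin⁻ f {i} h (k , off (iter-split s k) ne) })
      (λ h → cycleMin⁺ f {i} λ { (k , refl) → cycleMin⁻ f₂ {i} h (k , sym (off (iter-split s k) ne)) }))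
    (λ x → cycleMin⁺ f₂ {ι x} λ { (k , refl) → ℕₚ.≤-reflexive (cong toℕ (sym (fixed (iter-split s k) x))) })

  -- The points of `C` are fixed by `f₂` and add `countF C` cycles, the very amount by which the
  -- sizes of the two domains exceed `n`. Hence lengths add up although cycle counts do not.
  norm-split : ∀ {f f₁ f₂} → Split f f₁ f₂ → ∥ f ∥ ≡ ∥ f₁ ∥ + ∥ f₂ ∥
  norm-split {f} {f₁} {f₂} s = arithmetic (countF C) (cycles f) (cycles f₁) (cycles f₂)
    (cycles≤n f₁) (cycles≤n f₂) (cycles-split s)
    where
    arithmetic : ∀ k c c₁ c₂ → c₁ ≤ k → c₂ ≤ n → c + k ≡ c₁ + c₂ → n ∸ c ≡ (k ∸ c₁) + (n ∸ c₂)
    arithmetic k c c₁ c₂ c₁≤k c₂≤n e = begin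
      n ∸ c                        ≡⟨ cong (_∸ c) (sym (ℕₚ.m+[n∸m]≡n c₂≤n)) ⟩
      c₂ + (n ∸ c₂) ∸ c            ≡⟨ cong (λ m → m + (n ∸ c₂) ∸ c) c₂≡ ⟩
      c + (k ∸ c₁) + (n ∸ c₂) ∸ c  ≡⟨ cong (_∸ c) (ℕₚ.+-assoc c (k ∸ c₁) (n ∸ c₂)) ⟩
      c + (k ∸ c₁ + (n ∸ c₂)) ∸ c  ≡⟨ ℕₚ.m+n∸m≡n c _ ⟩
      k ∸ c₁ + (n ∸ c₂)            ∎
      where
      open ≡-Reasoning
      c₂≡ : c₂ ≡ c + (k ∸ c₁)
      c₂≡ = ℕₚ.+-cancelˡ-≡ c₁ c₂ (c + (k ∸ c₁)) (begin
        c₁ + c₂              ≡⟨ sym e ⟩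
        c + k                ≡⟨ cong (c +_) (sym (ℕₚ.m+[n∸m]≡n c₁≤k)) ⟩
        c + (c₁ + (k ∸ c₁))  ≡⟨ sym (ℕₚ.+-assoc c c₁ (k ∸ c₁)) ⟩
        c + c₁ + (k ∸ c₁)    ≡⟨ cong (_+ (k ∸ c₁)) (ℕₚ.+-comm c c₁) ⟩
        c₁ + c + (k ∸ c₁)    ≡⟨ ℕₚ.+-assoc c₁ c (k ∸ c₁) ⟩
        c₁ + (c + (k ∸ c₁))  ∎)

  -- `ι` is increasing and no block of `α` meets both `C` and its complement, so successors within a
  -- block can be computed in the part.
  perm-split : ∀ {α α₁ α₂} → Valid α → Valid α₁ → Valid α₂ → Split α α₁ α₂ →
    Split (perm α) (perm α₁) (perm α₂)
  perm-split {α} {α₁} {α₂} v v₁ v₂ s = record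
    { on = λ x → next-unique α (next-on (next-perm α₁ x))
    ; off = λ {i} ne → next-unique α (next-off ne (next-perm α₂ i))
    ; off-closed = λ {i} ne e → let x , e′ = ι-cover e in
        on≢off s {x} ne (trans (cong α (sym e′)) (perm-same v i))
    ; fixed = λ x → next-unique α₂ (wrap (sym (fixed s x)) λ {k} e → fixed-max x (view k) e) }
    where
    next-on : ∀ {x y} → Next α₁ x y → Next α (ι x) (ι y)
    next-on {x} {y} (step x<y e h) = step (ι-mono-< x<y) (trans (on s y) (trans (cong ι e) (sym (on s x))))
      λ {k} l e → after (view k) l e
      where
      after : ∀ {k} → View k → ι x Fin.< k → α k ≡ α (ι x) → ι y Fin.≤ k
      after (inn z) l e = ι-mono-≤ (h (ι-cancel-< l) (on-inj s e))
      after (out ne) l e = contradiction (sym e) (on≢off s ne)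
    next-on {x} {y} (wrap refl h) = wrap (sym (on s x)) λ {k} e → max (view k) e
      where
      max : ∀ {k} → View k → α k ≡ α (ι x) → k Fin.≤ ι x
      max (inn z) e = ι-mono-≤ (h (on-inj s e))
      max (out ne) e = contradiction (sym e) (on≢off s ne)
    off-same : ∀ {i k} → C i ≢ true → View k → α k ≡ α i → α₂ k ≡ α₂ i
    off-same ne (inn z) e = contradiction e (on≢off s ne)
    off-same ne (out ne′) e = trans (sym (off s ne′)) (trans e (off s ne))
    off-same₂ : ∀ {i k} → C i ≢ true → View k → α₂ k ≡ α₂ i → α k ≡ α i
    off-same₂ ne (inn z) e = contradiction e (on≢off₂ s ne)
    off-same₂ ne (out ne′) e = trans (off s ne′) (trans e (sym (off s ne)))
    next-off : ∀ {i j} → C i ≢ true → Next α₂ i j → Next α i j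
    next-off {i} {j} ne (step i<j e h) = step i<j (off-same₂ ne (view j) e)
      λ {k} l e → h l (off-same ne (view k) e)
    next-off {i} {j} ne (wrap refl h) = wrap (sym (off s ne)) λ {k} e → h (off-same ne (view k) e)
    fixed-max : ∀ x {k} → View k → α₂ k ≡ α₂ (ι x) → k Fin.≤ ι x
    fixed-max x (inn z) e = ℕₚ.≤-reflexive (cong toℕ (trans (sym (fixed s z)) (trans e (fixed s x))))
    fixed-max x (out ne) e = contradiction (sym e) (on≢off₂ s ne)

  dist-split : ∀ {α α₁ α₂ β β₁ β₂} → Valid α → Valid α₁ → Valid α₂ → Valid β → Valid β₁ → Valid β₂ →
    Split α α₁ α₂ → Split β β₁ β₂ → dist α β ≡ dist α₁ β₁ + dist α₂ β₂
  dist-split vα vα₁ vα₂ vβ vβ₁ vβ₂ s t = norm-split (comp-split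
    (inv-split (perm-inj vα) (perm-inj vα₁) (perm-inj vα₂) (perm-split vα vα₁ vα₂ s))
    (perm-split vβ vβ₁ vβ₂ t))

  ≗-split : ∀ {α α₁ α₂ β β₁ β₂} → Split α α₁ α₂ → Split β β₁ β₂ → α₁ ≗ β₁ → α₂ ≗ β₂ → α ≗ β
  ≗-split {α} {α₁} {α₂} {β} s t h₁ h₂ i = go (view i)
    where
    go : ∀ {i} → View i → α i ≡ β i
    go (inn x) = trans (on s x) (trans (cong ι (h₁ x)) (sym (on t x)))
    go {i} (out ne) = trans (off s ne) (trans (h₂ i) (sym (off t ne)))

  split-unique₁ : ∀ {α β α₁ α₂ β₁ β₂} → Split α α₁ α₂ → Split β β₁ β₂ → α ≗ β → α₁ ≗ β₁
  split-unique₁ s t h x = ι-inj (trans (sym (on s x)) (trans (h (ι x)) (on t x)))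

  split-unique₂ : ∀ {α β α₁ α₂ β₁ β₂} → Split α α₁ α₂ → Split β β₁ β₂ → α ≗ β → α₂ ≗ β₂
  split-unique₂ {α} {β} {α₁} {α₂} {β₁} {β₂} s t h i = go (view i)
    where
    go : ∀ {i} → View i → α₂ i ≡ β₂ i
    go (inn x) = trans (fixed s x) (sym (fixed t x))
    go {i} (out ne) = trans (sym (off s ne)) (trans (h i) (off t ne))

  separates-split⁻ : ∀ {α α₁ α₂ β β₁ β₂} → Split α α₁ α₂ → Split β β₁ β₂ → Separates α β →
    Separates α₁ β₁ × Separates α₂ β₂
  separates-split⁻ {α} {α₁} {α₂} {β} {β₁} {β₂} s t h =
    (λ p q → ι-inj (h (trans (on s _) (trans (cong ι p) (sym (on s _))))
                      (trans (on t _) (trans (cong ι q) (sym (on t _)))))) ,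
    (λ {i} {j} → go (view i) (view j))
    where
    go : ∀ {i j} → View i → View j → α₂ i ≡ α₂ j → β₂ i ≡ β₂ j → i ≡ j
    go (inn x) (inn y) p q = trans (sym (fixed s x)) (trans p (fixed s y))
    go (inn x) (out ne) p q = contradiction p (on≢off₂ s ne)
    go (out ne) (inn y) p q = contradiction (sym p) (on≢off₂ s ne)
    go (out ne) (out ne′) p q =
      h (trans (off s ne) (trans p (sym (off s ne′)))) (trans (off t ne) (trans q (sym (off t ne′))))

  separates-split⁺ : ∀ {α α₁ α₂ β β₁ β₂} → Split α α₁ α₂ → Split β β₁ β₂ →
    Separates α₁ β₁ → Separates α₂ β₂ → Separates α β
  separates-split⁺ {α} {α₁} {α₂} {β} s t h₁ h₂ {i} {j} = go (view i) (view j)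
    where
    go : ∀ {i j} → View i → View j → α i ≡ α j → β i ≡ β j → i ≡ j
    go (inn x) (inn y) p q = cong ι (h₁ (on-inj s p) (on-inj t q))
    go (inn x) (out ne) p q = contradiction p (on≢off s ne)
    go (out ne) (inn y) p q = contradiction (sym p) (on≢off s ne)
    go (out ne) (out ne′) p q =
      h₂ (trans (sym (off s ne)) (trans p (off s ne′))) (trans (sym (off t ne)) (trans q (off t ne′)))

  ⊑-split⁻ : ∀ {α α₁ α₂ γ γ₁ γ₂} → Split α α₁ α₂ → Split γ γ₁ γ₂ → α ⊑ γ → α₁ ⊑ γ₁ × α₂ ⊑ γ₂
  ⊑-split⁻ {α} {α₁} {α₂} {γ} {γ₁} {γ₂} s t h =
    (λ x → on-inj t (trans (cong γ (sym (on s x))) (h (ι x)))) , (λ i → go (view i))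
    where
    go : ∀ {i} → View i → γ₂ (α₂ i) ≡ γ₂ i
    go (inn x) = cong γ₂ (fixed s x)
    go (out ne) = trans (cong γ₂ (sym (off s ne)))
      (trans (sym (off t (off-closed s ne))) (trans (h _) (off t ne)))

  ⊑-split⁺ : ∀ {α α₁ α₂ γ γ₁ γ₂} → Split α α₁ α₂ → Split γ γ₁ γ₂ → α₁ ⊑ γ₁ → α₂ ⊑ γ₂ → α ⊑ γ
  ⊑-split⁺ {α} {α₁} {α₂} {γ} {γ₁} {γ₂} s t h₁ h₂ i = go (view i)
    where
    go : ∀ {i} → View i → γ (α i) ≡ γ i
    go (inn x) = trans (cong γ (on s x)) (trans (on t _) (trans (cong ι (h₁ x)) (sym (on t x))))
    go (out ne) = trans (off t (off-closed s ne)) (trans (cong γ₂ (off s ne)) (trans (h₂ _) (sym (off t ne))))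

  split-valid₁ : ∀ {α α₁ α₂} → Split α α₁ α₂ → Valid α → Valid α₁
  split-valid₁ {α} {α₁} s v = record
    { idem = λ x → on-inj s (trans (cong α (sym (on s x))) (idem v (ι x)))
    ; dec = λ x → ι-cancel-≤ (subst (Fin._≤ ι x) (on s x) (dec v (ι x)))
    ; nc = λ a<b b<c c<d ac bd → on-inj s (nc v (ι-mono-< a<b) (ι-mono-< b<c) (ι-mono-< c<d) (lift ac) (lift bd)) }
    where
    lift : ∀ {x y} → α₁ x ≡ α₁ y → α (ι x) ≡ α (ι y)
    lift e = trans (on s _) (trans (cong ι e) (sym (on s _)))

  split-valid₂ : ∀ {α α₁ α₂} → Split α α₁ α₂ → Valid α → Valid α₂
  split-valid₂ {α} {α₁} {α₂} s v = record
    { idem = λ i → idem₂ (view i)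
    ; dec = λ i → dec₂ (view i)
    ; nc = λ {a} {b} {c} {d} a<b b<c c<d ac bd →
        let a-off , e = proper (view a) (view c) (ℕₚ.<⇒≢ (ℕₚ.<-trans a<b b<c) ∘ cong toℕ) ac
            b-off , e′ = proper (view b) (view d) (ℕₚ.<⇒≢ (ℕₚ.<-trans b<c c<d) ∘ cong toℕ) bd
        in trans (sym (off s a-off)) (trans (nc v a<b b<c c<d e e′) (off s b-off)) }
    where
    idem₂ : ∀ {i} → View i → α₂ (α₂ i) ≡ α₂ i
    idem₂ (inn x) = cong α₂ (fixed s x)
    idem₂ (out ne) = trans (cong α₂ (sym (off s ne))) (trans (sym (off s (off-closed s ne))) (trans (idem v _) (off s ne)))
    dec₂ : ∀ {i} → View i → α₂ i Fin.≤ i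
    dec₂ (inn x) = ℕₚ.≤-reflexive (cong toℕ (fixed s x))
    dec₂ {i} (out ne) = subst (Fin._≤ i) (off s ne) (dec v i)
    -- A point of `C` is alone in its block of `α₂`, so two distinct points of one block lie outside
    -- `C`, where `α₂` is `α`.
    proper : ∀ {i j} → View i → View j → i ≢ j → α₂ i ≡ α₂ j → C i ≢ true × α i ≡ α j
    proper (inn x) (inn y) i≢j e = contradiction (trans (sym (fixed s x)) (trans e (fixed s y))) i≢j
    proper (inn x) (out ne) i≢j e = contradiction e (on≢off₂ s ne)
    proper (out ne) (inn y) i≢j e = contradiction (sym e) (on≢off₂ s ne)
    proper (out ne) (out ne′) i≢j e = ne , trans (off s ne) (trans e (sym (off s ne′)))

  -- The default `x` is reached only when `α` leads out of `C`.
  restrict : Partition n → Partition (countF C)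
  restrict α x = minSat (λ y → ι y == α (ι x)) x

  explode : Partition n → Partition n
  explode α i = if C i then i else α i

  restrict-split : ∀ {α} → (∀ i → C (α i) ≡ C i) → Split α (restrict α) (explode α)
  restrict-split {α} closed = record
    { on = λ x → let y , e = ι-cover (trans (closed (ι x)) (ι-in x)) in
        sym (==⁻ (minSat-sat (λ y → ι y == α (ι x)) x {y} (==⁺ (sym e))))
    ; off = λ ne → sym (if-false ne)
    ; off-closed = λ {i} ne e → ne (trans (sym (closed i)) e)
    ; fixed = λ x → if-true (ι-in x) }

  private
    glue-at : Partition (countF C) → Partition n → ∀ {i} → View i → Fin n
    glue-at α₁ α₂ (inn x) = ι (α₁ x)
    glue-at α₁ α₂ {i} (out _) = α₂ i

    glue-inn : ∀ α₁ α₂ {i} (w : View i) {x} → i ≡ ι x → glue-at α₁ α₂ w ≡ ι (α₁ x)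
    glue-inn α₁ α₂ (inn y) e = cong (ι ∘ α₁) (ι-inj e)
    glue-inn α₁ α₂ (out ne) {x} e = contradiction (trans (cong C e) (ι-in x)) ne

    glue-out : ∀ α₁ α₂ {i} (w : View i) → C i ≢ true → glue-at α₁ α₂ w ≡ α₂ i
    glue-out α₁ α₂ (inn x) ne = contradiction (ι-in x) ne
    glue-out α₁ α₂ (out _) _ = refl

  glue : Partition (countF C) → Partition n → Partition n
  glue α₁ α₂ i = glue-at α₁ α₂ (view i)

  glue-split : ∀ {α₁ α₂} → (∀ x → α₂ (ι x) ≡ ι x) → (∀ {i} → C i ≢ true → C (α₂ i) ≢ true) →
    Split (glue α₁ α₂) α₁ α₂
  glue-split {α₁} {α₂} fix closed = record
    { on = λ x → glue-inn α₁ α₂ (view (ι x)) refl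
    ; off = λ {i} ne → glue-out α₁ α₂ (view i) ne
    ; off-closed = λ {i} ne → subst (λ j → C j ≢ true) (sym (glue-out α₁ α₂ (view i) ne)) (closed ne)
    ; fixed = fix }

-- Partitions below σ, split along one block of σ

module Block {n} {σ : Partition n} (vσ : Valid σ) {r : Fin n} (σr≡r : σ r ≡ r) where
  C : Fin n → Bool
  C j = σ j == r

  open Members C public
  open Split

  σ₂ : Partition n
  σ₂ = explode σ

  ⊑-closed : ∀ {α} → α ⊑ σ → ∀ i → C (α i) ≡ C i
  ⊑-closed h i = cong (_== r) (h i)

  ⊑-split : ∀ {α} → α ⊑ σ → Split α (restrict α) (explode α)
  ⊑-split h = restrict-split (⊑-closed h)

  σ-split : Split σ top σ₂
  σ-split = record
    { on = λ x → trans (==⁻ (ι-in x)) (sym (ι-top x))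
    ; off = off s ; off-closed = off-closed s ; fixed = fixed s }
    where
    s : Split σ (restrict σ) σ₂
    s = ⊑-split (idem vσ)
    ι-top : ∀ x → ι (top x) ≡ r
    ι-top x = let x₀ , r≡ = ι-cover (==⁺ σr≡r) in Finₚ.≤-antisym
      (subst (ι (top x) Fin.≤_) (sym r≡) (ι-mono-≤ (top-≤ x x₀)))
      (subst (Fin._≤ ι (top x)) (==⁻ (ι-in (top x))) (dec vσ (ι (top x))))

  σ₂-valid : Valid σ₂
  σ₂-valid = split-valid₂ σ-split vσ

  -- The points of the block are singletons of `σ₂`, so a partition below `σ₂` fixes them and sends
  -- no other point to them.
  glue-⊑-split : ∀ {α₁ α₂} → α₂ ⊑ σ₂ → Split (glue α₁ α₂) α₁ α₂
  glue-⊑-split {α₁} {α₂} h = glue-split (λ x → fix x (view (α₂ (ι x))) refl)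
    λ {i} ne → subst (λ b → b ≢ true) (sym (closed ne (view (α₂ i)) refl)) ne
    where
    fix : ∀ x {j} → View j → j ≡ α₂ (ι x) → α₂ (ι x) ≡ ι x
    fix x (inn y) e = trans (sym e) (trans (sym (fixed σ-split y)) (trans (cong σ₂ e) (trans (h (ι x)) (fixed σ-split x))))
    fix x (out ne) e = contradiction (trans (sym (h (ι x))) (cong σ₂ (sym e))) (on≢off₂ σ-split ne)
    closed : ∀ {i j} → C i ≢ true → View j → j ≡ α₂ i → C (α₂ i) ≡ C i
    closed ne (inn y) e = contradiction (trans (cong σ₂ e) (h _)) (on≢off₂ σ-split ne)
    closed ne (out ne′) refl = cong (_== r) (trans (off σ-split ne′) (trans (h _) (sym (off σ-split ne))))

  split-⊑ : ∀ {α α₁ α₂} → Split α α₁ α₂ → α₂ ⊑ σ₂ → α ⊑ σ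
  split-⊑ {α₁ = α₁} s h = ⊑-split⁺ s σ-split (⊑-top α₁) h

  -- Two crossing pairs of `α` lie in one block of `σ`, which is coarser and non-crossing. So the
  -- four points are all inside `C` or all outside, and one of the parts rules the crossing out.
  split-valid : ∀ {α α₁ α₂} → Split α α₁ α₂ → Valid α₁ → Valid α₂ → α₂ ⊑ σ₂ → Valid α
  split-valid {α} {α₁} {α₂} s v₁ v₂ h = record
    { idem = λ i → idem′ (view i)
    ; dec = λ i → dec′ (view i)
    ; nc = λ {a} {b} {c} {d} a<b b<c c<d ac bd →
        nc′ (view a) (view b) (view c) (view d) a<b b<c c<d ac bd
          (nc vσ a<b b<c c<d (⊑-same α⊑σ ac) (⊑-same α⊑σ bd)) }
    where
    α⊑σ : α ⊑ σ
    α⊑σ = split-⊑ s h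
    idem′ : ∀ {i} → View i → α (α i) ≡ α i
    idem′ (inn x) = trans (cong α (on s x)) (trans (on s _) (trans (cong ι (idem v₁ x)) (sym (on s x))))
    idem′ (out ne) = trans (off s (off-closed s ne)) (trans (cong α₂ (off s ne)) (trans (idem v₂ _) (sym (off s ne))))
    dec′ : ∀ {i} → View i → α i Fin.≤ i
    dec′ (inn x) = subst (Fin._≤ ι x) (sym (on s x)) (ι-mono-≤ (dec v₁ x))
    dec′ {i} (out ne) = subst (Fin._≤ i) (sym (off s ne)) (dec v₂ i)
    nc′ : ∀ {a b c d} → View a → View b → View c → View d → a Fin.< b → b Fin.< c → c Fin.< d →
      α a ≡ α c → α b ≡ α d → σ a ≡ σ b → α a ≡ α b
    nc′ (inn a) (inn b) (inn c) (inn d) a<b b<c c<d ac bd _ = trans (on s a) (trans (cong ι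
      (nc v₁ (ι-cancel-< a<b) (ι-cancel-< b<c) (ι-cancel-< c<d) (on-inj s ac) (on-inj s bd))) (sym (on s b)))
    nc′ (out a) (out b) (out c) (out d) a<b b<c c<d ac bd _ = trans (off s a) (trans
      (nc v₂ a<b b<c c<d (trans (sym (off s a)) (trans ac (off s c))) (trans (sym (off s b)) (trans bd (off s d))))
      (sym (off s b)))
    nc′ (inn a) (out b) _ _ _ _ _ _ _ e = contradiction (trans (cong (_== r) (sym e)) (ι-in a)) b
    nc′ (out a) (inn b) _ _ _ _ _ _ _ e = contradiction (trans (cong (_== r) e) (ι-in b)) a
    nc′ (inn a) (inn b) (out c) _ _ _ _ ac _ _ = contradiction ac (on≢off s c)
    nc′ (inn a) (inn b) (inn c) (out d) _ _ _ _ bd _ = contradiction bd (on≢off s d)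
    nc′ (out a) (out b) (inn c) _ _ _ _ ac _ _ = contradiction (sym ac) (on≢off s a)
    nc′ (out a) (out b) (out c) (inn d) _ _ _ _ bd _ = contradiction (sym bd) (on≢off s b)

  join-split⁻ : ∀ {α α₁ α₂ β β₁ β₂} → Split α α₁ α₂ → Split β β₁ β₂ →
    IsJoin α β σ → IsJoin α₁ β₁ top × IsJoin α₂ β₂ σ₂
  join-split⁻ {α₁ = α₁} {α₂} {β₁ = β₁} {β₂} s t J =
    record { upperˡ = ⊑-top α₁ ; upperʳ = ⊑-top β₁ ; minimal = minimal₁ } ,
    record { upperˡ = α₂⊑σ₂ ; upperʳ = β₂⊑σ₂ ; minimal = minimal₂ }
    where
    α₂⊑σ₂ : α₂ ⊑ σ₂
    α₂⊑σ₂ = proj₂ (⊑-split⁻ s σ-split (upperˡ J))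
    β₂⊑σ₂ : β₂ ⊑ σ₂
    β₂⊑σ₂ = proj₂ (⊑-split⁻ t σ-split (upperʳ J))
    minimal₁ : ∀ {γ₁} → Valid γ₁ → α₁ ⊑ γ₁ → β₁ ⊑ γ₁ → top ⊑ γ₁
    -- Gluing `γ₁` to `σ₂` gives an upper bound on all points, to which the minimality of `σ`
    -- applies.
    minimal₁ {γ₁} v p q = proj₁ (⊑-split⁻ σ-split g (minimal J (split-valid g v σ₂-valid (idem σ₂-valid))
      (⊑-split⁺ s g p α₂⊑σ₂) (⊑-split⁺ t g q β₂⊑σ₂)))
      where
      g : Split (glue γ₁ σ₂) γ₁ σ₂
      g = glue-⊑-split (idem σ₂-valid)
    minimal₂ : ∀ {γ₂} → Valid γ₂ → α₂ ⊑ γ₂ → β₂ ⊑ γ₂ → σ₂ ⊑ γ₂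
    -- An upper bound `γ₂` may join the block to other points and so cannot be glued; its meet with
    -- `σ₂` can.
    minimal₂ {γ₂} v p q = ⊑-trans (proj₂ (⊑-split⁻ σ-split g (minimal J
      (split-valid g top-valid (meet-valid γ₂ σ₂ v σ₂-valid) (meet-⊑ʳ γ₂ σ₂))
      (⊑-split⁺ s g (⊑-top α₁) (meet-greatest γ₂ σ₂ p α₂⊑σ₂))
      (⊑-split⁺ t g (⊑-top β₁) (meet-greatest γ₂ σ₂ q β₂⊑σ₂))))) (meet-⊑ˡ γ₂ σ₂)
      where
      g : Split (glue top (γ₂ ∧ₙ σ₂)) top (γ₂ ∧ₙ σ₂)
      g = glue-⊑-split (meet-⊑ʳ γ₂ σ₂)

  join-split⁺ : ∀ {α α₁ α₂ β β₁ β₂} → Split α α₁ α₂ → Split β β₁ β₂ →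
    IsJoin α₁ β₁ top → IsJoin α₂ β₂ σ₂ → IsJoin α β σ
  join-split⁺ {α} {α₁} {α₂} {β} {β₁} {β₂} s t J₁ J₂ =
    record { upperˡ = α⊑σ ; upperʳ = β⊑σ ; minimal = minimal′ }
    where
    α⊑σ : α ⊑ σ
    α⊑σ = split-⊑ s (upperˡ J₂)
    β⊑σ : β ⊑ σ
    β⊑σ = split-⊑ t (upperʳ J₂)
    minimal′ : ∀ {γ} → Valid γ → α ⊑ γ → β ⊑ γ → σ ⊑ γ
    -- The bound `γ` need not respect the block, but its meet with `σ` does and is still an upper
    -- bound.
    minimal′ {γ} v p q = ⊑-trans (⊑-split⁺ σ-split g
      (minimal J₁ (split-valid₁ g vδ) (proj₁ αδ) (proj₁ βδ))
      (minimal J₂ (split-valid₂ g vδ) (proj₂ αδ) (proj₂ βδ))) (meet-⊑ˡ γ σ)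
      where
      δ : Partition n
      δ = γ ∧ₙ σ
      vδ : Valid δ
      vδ = meet-valid γ σ v vσ
      g : Split δ (restrict δ) (explode δ)
      g = ⊑-split (meet-⊑ʳ γ σ)
      αδ : α₁ ⊑ restrict δ × α₂ ⊑ explode δ
      αδ = ⊑-split⁻ s g (meet-greatest γ σ p α⊑σ)
      βδ : β₁ ⊑ restrict δ × β₂ ⊑ explode δ
      βδ = ⊑-split⁻ t g (meet-greatest γ σ q β⊑σ)

  explode-min : ∀ {m} → σ m ≡ m → m ≢ r → σ₂ m ≡ m
  explode-min {m} e m≢r = trans (if-false λ c → m≢r (trans (sym e) (==⁻ c))) e

  -- Exploding one block leaves the sizes of the others alone, so the remaining factors of the
  -- product are unchanged.
  explode-size : ∀ {m} → σ m ≡ m → m ≢ r → blockSize σ₂ m ≡ blockSize σ m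
  explode-size {m} e m≢r = countF-cong {P = λ j → σ₂ j == m} {λ j → σ j == m} λ j → go (view j)
    where
    go : ∀ {j} → View j → (σ₂ j == m) ≡ (σ j == m)
    go (inn x) = true-ext
      (λ h → contradiction (trans (sym e) (trans (cong σ (sym (trans (sym (fixed σ-split x)) (==⁻ h)))) (==⁻ (ι-in x)))) m≢r)
      (λ h → contradiction (trans (sym (==⁻ h)) (==⁻ (ι-in x))) m≢r)
    go (out ne) = cong (_== m) (sym (off σ-split ne))
-- The moment-cumulant formula

dist-cong : {α α′ β β′ : Partition n} → α ≗ α′ → β ≗ β′ → dist α β ≡ dist α′ β′
dist-cong {n} {α} {α′} {β} h h′ = cong (n ∸_) (cycles-cong λ i →
  trans (inv-cong (perm-cong h) (perm β i)) (cong (inv (perm α′)) (perm-cong h′ i)))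

norm-cong : {α β : Partition n} → α ≗ β → ∥ α ∥ₚ ≡ ∥ β ∥ₚ
norm-cong {n} h = cong (n ∸_) (cycles-cong (perm-cong h))

join-test-cong : {α α′ β β′ σ σ′ : Partition n} → Valid α → Valid β → Valid α′ → Valid β′ → Valid σ′ →
  α ≗ α′ → β ≗ β′ → σ ≗ σ′ → (α ∨ₙ β) ≐ σ ≡ true → (α′ ∨ₙ β′) ≐ σ′ ≡ true
join-test-cong vα vβ vα′ vβ′ vσ′ hα hβ hσ e = join⁺ vα′ vβ′ vσ′ (IsJoin-resp hα hβ hσ (join⁻ vα vβ e))

module Cumulants {c ℓ} (R : CommutativeRing c ℓ) where
  open CommutativeRing R
    using (Carrier; _≈_; _*_; 0#; 1#; setoid; reflexive; *-cong; *-congˡ; *-congʳ; *-assoc; *-identityˡ; *-identityʳ;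
           zeroˡ; zeroʳ; distribˡ; distribʳ; +-congˡ; +-congʳ; +-commutativeMonoid; *-commutativeMonoid)
    renaming (refl to ≈-refl; sym to ≈-sym; trans to ≈-trans)
  open Poly R
  open Sum +-commutativeMonoid
  open import Algebra.Properties.CommutativeSemigroup (CommutativeMonoid.commutativeSemigroup *-commutativeMonoid)
    using (interchange)
  open import Relation.Binary.Reasoning.Setoid setoid

  private
    variable
      v : Level
      V : Set v

  when-true : ∀ {b x} → b ≡ true → when b x ≈ x
  when-true refl = ≈-refl

  when-false : ∀ {b x} → b ≢ true → when b x ≈ 0#
  when-false {false} h = ≈-refl
  when-false {true} h = contradiction refl h

  when-congʳ : ∀ {b x y} → (b ≡ true → x ≈ y) → when b x ≈ when b y
  when-congʳ {false} h = ≈-refl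
  when-congʳ {true} h = h refl

  when-cong : ∀ {b c x y} → (b ≡ true → c ≡ true) → (c ≡ true → b ≡ true) → (b ≡ true → x ≈ y) →
    when b x ≈ when c y
  when-cong h h′ e = ≈-trans (when-congʳ e) (reflexive (cong (λ b → when b _) (true-ext h h′)))

  when-∧ : ∀ b c {x} → when (b ∧ c) x ≈ when b (when c x)
  when-∧ false c = ≈-refl
  when-∧ true c = ≈-refl

  when-* : ∀ b c {x y} → when (b ∧ c) (x * y) ≈ when b x * when c y
  when-* false c = ≈-sym (zeroˡ _)
  when-* true false = ≈-sym (zeroʳ _)
  when-* true true = ≈-refl

  when-sum : ∀ b (xs : List V) {f : V → Carrier} → when b (sum xs f) ≈ sum xs (λ x → when b (f x))
  when-sum true xs = ≈-refl
  when-sum false xs = ≈-sym (sum-ε xs λ _ → ≈-refl)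

  sum-distribˡ : ∀ x (xs : List V) {f : V → Carrier} → x * sum xs f ≈ sum xs (λ y → x * f y)
  sum-distribˡ x [] = zeroʳ x
  sum-distribˡ x (y ∷ xs) = ≈-trans (distribˡ x _ _) (+-congˡ (sum-distribˡ x xs))

  sum-distribʳ : ∀ x (xs : List V) {f : V → Carrier} → sum xs f * x ≈ sum xs (λ y → f y * x)
  sum-distribʳ x [] = zeroˡ x
  sum-distribʳ x (y ∷ xs) = ≈-trans (distribʳ x _ _) (+-congˡ (sum-distribʳ x xs))

  Π-cong : {f g : V → Carrier} (xs : List V) → (∀ {x} → x ∈ xs → f x ≈ g x) → Π xs f ≈ Π xs g
  Π-cong [] h = ≈-refl
  Π-cong (x ∷ xs) h = *-cong (h (here refl)) (Π-cong xs (h ∘ there))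

  pow-+ : ∀ x m l → pow x (m + l) ≈ pow x m * pow x l
  pow-+ x zero l = ≈-sym (*-identityˡ _)
  pow-+ x (suc m) l = ≈-trans (*-congˡ (pow-+ x m l)) (≈-sym (*-assoc _ _ _))

  ΣNC-cong : {f g : Partition n → Carrier} → (∀ {α} → Valid α → f α ≈ g α) → sum (NC n) f ≈ sum (NC n) g
  ΣNC-cong = sum-cong-All NC-valid

  Σ₂-cong : {f g : Partition n → Partition n → Carrier} →
    (∀ {α β} → Valid α → Valid β → f α β ≈ g α β) → Σ₂ n f ≈ Σ₂ n g
  Σ₂-cong h = ΣNC-cong λ vα → ΣNC-cong λ vβ → h vα vβ

  module _ {n} {σ : Partition n} (vσ : Valid σ) {r : Fin n} (σr≡r : σ r ≡ r) where
    private module M = Block vσ σr≡r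
    open M using (restrict; explode; glue; σ₂; ⊑-split; glue-⊑-split; split-⊑; split-valid; split-valid₁; split-valid₂;
                  ⊑-split⁻; σ-split; ≗-split; split-unique₁; split-unique₂)

    size : ℕ
    size = countF M.C

    -- Partitions below `σ` correspond to pairs of any partition of the block and one below `σ₂`.
    -- The matrix `m` is supported on the graph of this bijection, with restriction and explosion in
    -- one direction and gluing in the other.
    sum-glue : (h : Partition n → Carrier) → (∀ {α β} → Valid α → Valid β → α ≗ β → h α ≈ h β) →
      sum (NC n) (λ α → when (α ≼ σ) (h α)) ≈
      sum (NC size) (λ α₁ → sum (NC n) λ α₂ → when (α₂ ≼ σ₂) (h (glue α₁ α₂)))
    sum-glue h h-cong = begin
      sum (NC n) (λ α → when (α ≼ σ) (h α))
        ≈⟨ ΣNC-cong (λ vα → ≈-sym (row vα)) ⟩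
      sum (NC n) (λ α → sum (NC size) λ α₁ → sum (NC n) λ α₂ → m α α₁ α₂)
        ≈⟨ sum-swap (NC n) (NC size) _ ⟩
      sum (NC size) (λ α₁ → sum (NC n) λ α → sum (NC n) λ α₂ → m α α₁ α₂)
        ≈⟨ sum-cong (NC size) (λ α₁ → sum-swap (NC n) (NC n) _) ⟩
      sum (NC size) (λ α₁ → sum (NC n) λ α₂ → sum (NC n) λ α → m α α₁ α₂)
        ≈⟨ ΣNC-cong (λ v₁ → ΣNC-cong λ v₂ → column v₁ v₂) ⟩
      sum (NC size) (λ α₁ → sum (NC n) λ α₂ → when (α₂ ≼ σ₂) (h (glue α₁ α₂))) ∎
      where
      m : Partition n → Partition size → Partition n → Carrier
      m α α₁ α₂ = when (restrict α ≐ α₁) (when (explode α ≐ α₂) (when (α ≼ σ) (h α)))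
      m-true : ∀ {α α₁ α₂} → restrict α ≗ α₁ → explode α ≗ α₂ → α ⊑ σ → m α α₁ α₂ ≈ h α
      m-true {α} {α₁} {α₂} p q s = ≈-trans (when-true (≐⁺ {p = restrict α} {α₁} p))
        (≈-trans (when-true (≐⁺ {p = explode α} {α₂} q)) (when-true (≼⁺ s)))
      m-false : ∀ {α α₁ α₂} → Valid α → (restrict α ≗ α₁ → explode α ≗ α₂ → α ⊑ σ → ⊥) → m α α₁ α₂ ≈ 0#
      m-false {α} {α₁} {α₂} vα absurd with (restrict α ≐ α₁) true?
      ... | no ne = when-false ne
      ... | yes p with (explode α ≐ α₂) true?
      ...   | no ne = ≈-trans (when-true p) (when-false ne)
      ...   | yes q = ≈-trans (when-true p) (≈-trans (when-true q)
                (when-false λ s → absurd (≐⁻ {p = restrict α} {α₁} p) (≐⁻ {p = explode α} {α₂} q) (≼⁻ vα s)))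
      row : ∀ {α} → Valid α → sum (NC size) (λ α₁ → sum (NC n) λ α₂ → m α α₁ α₂) ≈ when (α ≼ σ) (h α)
      row {α} vα with (α ≼ σ) true?
      ... | no ne = ≈-trans (sum-ε (NC size) λ α₁ → sum-ε (NC n) λ α₂ → m-false vα λ _ _ s → ne (≼⁺ s))
                            (≈-sym (when-false ne))
      ... | yes e = begin
        sum (NC size) (λ α₁ → sum (NC n) λ α₂ → m α α₁ α₂)
          ≈⟨ NC-single (split-valid₁ s vα) _
               (λ _ p → sum-cong (NC n) λ α₂ → when-cong {restrict α ≐ _} {restrict α ≐ restrict α}
                 (λ _ → ≐-refl (restrict α)) (λ _ → ≐⁺ {p = restrict α} λ x → sym (p x)) λ _ → ≈-refl)
               (λ _ ne → sum-ε (NC n) λ α₂ → m-false vα λ p _ _ → ne λ x → sym (p x)) ⟩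
        sum (NC n) (λ α₂ → m α (restrict α) α₂)
          ≈⟨ NC-single (split-valid₂ s vα) _
               (λ _ p → when-congʳ {restrict α ≐ restrict α} λ _ → when-cong {explode α ≐ _} {explode α ≐ explode α}
                 (λ _ → ≐-refl (explode α)) (λ _ → ≐⁺ {p = explode α} λ x → sym (p x)) λ _ → ≈-refl)
               (λ _ ne → m-false vα λ _ p _ → ne λ x → sym (p x)) ⟩
        m α (restrict α) (explode α)
          ≈⟨ m-true (λ _ → refl) (λ _ → refl) (≼⁻ vα e) ⟩
        h α
          ≈⟨ ≈-sym (when-true e) ⟩
        when (α ≼ σ) (h α) ∎
        where
        s : M.Split α (restrict α) (explode α)
        s = ⊑-split (≼⁻ vα e)
      column : ∀ {α₁ α₂} → Valid α₁ → Valid α₂ →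
        sum (NC n) (λ α → m α α₁ α₂) ≈ when (α₂ ≼ σ₂) (h (glue α₁ α₂))
      column {α₁} {α₂} v₁ v₂ with (α₂ ≼ σ₂) true?
      ... | no ne = ≈-trans (≈-trans
              (ΣNC-cong λ {α} vα → m-false {α} vα λ _ q s → ne (≼⁺ (⊑-resp q (λ _ → refl)
                (proj₂ (⊑-split⁻ (⊑-split s) σ-split s)))))
              (sum-ε (NC n) λ _ → ≈-refl)) (≈-sym (when-false ne))
      ... | yes e = ≈-trans (NC-single vg (λ α → m α α₁ α₂)
              (λ vα p → let s = split-⊑ g α₂⊑σ₂
                            s′ = ⊑-resp (λ i → sym (p i)) (λ _ → refl) s in
                ≈-trans (m-true (split-unique₁ (⊑-split s′) g p) (split-unique₂ (⊑-split s′) g p) s′)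
                  (≈-trans (h-cong vα vg p) (≈-sym (m-g))))
              (λ vα ne → m-false vα λ p q s → ne (≗-split (⊑-split s) g p q)))
            (≈-trans m-g (≈-sym (when-true e)))
        where
        α₂⊑σ₂ : α₂ ⊑ σ₂
        α₂⊑σ₂ = ≼⁻ v₂ e
        g : M.Split (glue α₁ α₂) α₁ α₂
        g = glue-⊑-split α₂⊑σ₂
        vg : Valid (glue α₁ α₂)
        vg = split-valid g v₁ v₂ α₂⊑σ₂
        m-g : m (glue α₁ α₂) α₁ α₂ ≈ h (glue α₁ α₂)
        m-g = m-true (split-unique₁ (⊑-split (split-⊑ g α₂⊑σ₂)) g (λ _ → refl))
                     (split-unique₂ (⊑-split (split-⊑ g α₂⊑σ₂)) g (λ _ → refl)) (split-⊑ g α₂⊑σ₂)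

  -- Weights that factor over blocks

  record Weight : Set (c ⊔ ℓ) where
    field
      W : Partition n → Partition n → Partition n → Carrier
      W-cong : {α α′ β β′ σ σ′ : Partition n} → α ≗ α′ → β ≗ β′ → σ ≗ σ′ → W α β σ ≈ W α′ β′ σ′
      W-bot : W {n} bot bot bot ≈ 1#
      -- Factoring off a single block is enough: blocks are exploded in turn until `W-bot` applies.
      W-split : {σ : Partition n} (vσ : Valid σ) {r : Fin n} (σr≡r : σ r ≡ r) → let open Block vσ σr≡r in
        ∀ {α α₁ α₂ β β₁ β₂} → Valid α → Valid α₁ → Valid α₂ → Valid β → Valid β₁ → Valid β₂ →
        Split α α₁ α₂ → Split β β₁ β₂ → W α β σ ≈ W α₁ β₁ top * W α₂ β₂ σ₂

  module _ (𝓦 : Weight) where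
    open Weight 𝓦

    fibre : Partition n → Partition n → Partition n → Carrier
    fibre σ α β = when ((α ∨ₙ β) ≐ σ) (W α β σ)

    -- The share of the pairs whose join is `σ`; at `top` it is the cumulant.
    Θ : Partition n → Carrier
    Θ {n} σ = Σ₂ n (fibre σ)

    fibre-cong : {σ α α′ β β′ : Partition n} → Valid σ → Valid α → Valid α′ → Valid β → Valid β′ →
      α ≗ α′ → β ≗ β′ → fibre σ α β ≈ fibre σ α′ β′
    fibre-cong vσ vα vα′ vβ vβ′ hα hβ = when-cong
      (join-test-cong vα vβ vα′ vβ′ vσ hα hβ (λ _ → refl))
      (join-test-cong vα′ vβ′ vα vβ vσ (λ i → sym (hα i)) (λ i → sym (hβ i)) (λ _ → refl))
      (λ _ → W-cong hα hβ λ _ → refl)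

    module _ {n} {σ : Partition n} (vσ : Valid σ) {r : Fin n} (σr≡r : σ r ≡ r) where
      private module M = Block vσ σr≡r
      open M using (glue; σ₂; σ₂-valid; glue-⊑-split; split-valid; join-split⁻; join-split⁺)

      -- The guards on the left make the gluing legitimate. On the right they follow from the join
      -- being `σ₂`, which bounds `α₂` and `β₂`.
      fibre-split : ∀ {α₁ α₂ β₁ β₂} → Valid α₁ → Valid α₂ → Valid β₁ → Valid β₂ →
        when (α₂ ≼ σ₂) (when (β₂ ≼ σ₂) (fibre σ (glue α₁ α₂) (glue β₁ β₂))) ≈ fibre top α₁ β₁ * fibre σ₂ α₂ β₂
      fibre-split {α₁} {α₂} {β₁} {β₂} vα₁ vα₂ vβ₁ vβ₂ = begin
        when (α₂ ≼ σ₂) (when (β₂ ≼ σ₂) (when J (W α β σ)))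
          ≈⟨ when-congʳ {α₂ ≼ σ₂} (λ _ → ≈-sym (when-∧ (β₂ ≼ σ₂) J)) ⟩
        when (α₂ ≼ σ₂) (when ((β₂ ≼ σ₂) ∧ J) (W α β σ))
          ≈⟨ ≈-sym (when-∧ (α₂ ≼ σ₂) ((β₂ ≼ σ₂) ∧ J)) ⟩
        when ((α₂ ≼ σ₂) ∧ (β₂ ≼ σ₂) ∧ J) (W α β σ)
          ≈⟨ when-cong to from weights ⟩
        when (J₁ ∧ J₂) (W α₁ β₁ top * W α₂ β₂ σ₂)
          ≈⟨ when-* J₁ J₂ ⟩
        fibre top α₁ β₁ * fibre σ₂ α₂ β₂ ∎
        where
        α β : Partition n
        α = glue α₁ α₂
        β = glue β₁ β₂
        J J₁ J₂ : Bool
        J = (α ∨ₙ β) ≐ σ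
        J₁ = (α₁ ∨ₙ β₁) ≐ top
        J₂ = (α₂ ∨ₙ β₂) ≐ σ₂
        module _ (p : α₂ ⊑ σ₂) (q : β₂ ⊑ σ₂) where
          s : M.Split α α₁ α₂
          s = glue-⊑-split p
          t : M.Split β β₁ β₂
          t = glue-⊑-split q
          vα : Valid α
          vα = split-valid s vα₁ vα₂ p
          vβ : Valid β
          vβ = split-valid t vβ₁ vβ₂ q
        to : (α₂ ≼ σ₂) ∧ (β₂ ≼ σ₂) ∧ J ≡ true → J₁ ∧ J₂ ≡ true
        to e =
          let e₁ , e′ = ∧⁻ {α₂ ≼ σ₂} e
              e₂ , j = ∧⁻ {β₂ ≼ σ₂} e′
              p = ≼⁻ vα₂ e₁
              q = ≼⁻ vβ₂ e₂
              j₁ , j₂ = join-split⁻ (s p q) (t p q) (join⁻ (vα p q) (vβ p q) j)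
          in ∧⁺ {J₁} (join⁺ vα₁ vβ₁ top-valid j₁) (join⁺ vα₂ vβ₂ σ₂-valid j₂)
        from : J₁ ∧ J₂ ≡ true → (α₂ ≼ σ₂) ∧ (β₂ ≼ σ₂) ∧ J ≡ true
        from e =
          let e₁ , e₂ = ∧⁻ {J₁} e
              j₁ = join⁻ vα₁ vβ₁ e₁
              j₂ = join⁻ vα₂ vβ₂ e₂
              p = upperˡ j₂
              q = upperʳ j₂
          in ∧⁺ {α₂ ≼ σ₂} (≼⁺ p) (∧⁺ {β₂ ≼ σ₂} (≼⁺ q)
               (join⁺ (vα p q) (vβ p q) vσ (join-split⁺ (s p q) (t p q) j₁ j₂)))
        weights : (α₂ ≼ σ₂) ∧ (β₂ ≼ σ₂) ∧ J ≡ true → W α β σ ≈ W α₁ β₁ top * W α₂ β₂ σ₂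
        weights e =
          let e₁ , e′ = ∧⁻ {α₂ ≼ σ₂} e
              e₂ , _ = ∧⁻ {β₂ ≼ σ₂} e′
              p = ≼⁻ vα₂ e₁
              q = ≼⁻ vβ₂ e₂
          in W-split vσ σr≡r (vα p q) vα₁ vα₂ (vβ p q) vβ₁ vβ₂ (s p q) (t p q)

      -- Both members of a pair with join `σ` lie below `σ`, so guards can be inserted and each of
      -- the two sums replaced by a sum over glued pairs. The fourfold sum then separates into a
      -- product.
      Θ-split : Θ σ ≈ Θ {blockSize σ r} top * Θ σ₂
      Θ-split = begin
        sum (NC n) (λ α → sum (NC n) (fibre σ α))
          ≈⟨ ΣNC-cong (λ {α} vα → ≈-trans (ΣNC-cong λ {β} vβ → below {α} {β} vα vβ) (≈-sym (when-sum (α ≼ σ) (NC n)))) ⟩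
        sum (NC n) (λ α → when (α ≼ σ) (sum (NC n) λ β → when (β ≼ σ) (fibre σ α β)))
          ≈⟨ sum-glue vσ σr≡r _ (λ vα vα′ e → ΣNC-cong λ {β} vβ → when-congʳ {β ≼ σ} λ _ →
               fibre-cong vσ vα vα′ vβ vβ e λ _ → refl) ⟩
        sum (NC l) (λ α₁ → sum (NC n) λ α₂ → when (α₂ ≼ σ₂)
          (sum (NC n) λ β → when (β ≼ σ) (fibre σ (glue α₁ α₂) β)))
          ≈⟨ ΣNC-cong (λ v₁ → ΣNC-cong λ v₂ → inner v₁ v₂) ⟩
        sum (NC l) (λ α₁ → sum (NC n) λ α₂ → sum (NC l) λ β₁ → sum (NC n) λ β₂ → fibre top α₁ β₁ * fibre σ₂ α₂ β₂)
          ≈⟨ sum-cong (NC l) (λ α₁ → sum-swap (NC n) (NC l) _) ⟩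
        sum (NC l) (λ α₁ → sum (NC l) λ β₁ → sum (NC n) λ α₂ → sum (NC n) λ β₂ → fibre top α₁ β₁ * fibre σ₂ α₂ β₂)
          ≈⟨ sum-cong (NC l) (λ α₁ → sum-cong (NC l) λ β₁ → ≈-trans
               (sum-cong (NC n) λ α₂ → ≈-sym (sum-distribˡ (fibre top α₁ β₁) (NC n)))
               (≈-sym (sum-distribˡ (fibre top α₁ β₁) (NC n)))) ⟩
        sum (NC l) (λ α₁ → sum (NC l) λ β₁ → fibre top α₁ β₁ * Θ σ₂)
          ≈⟨ ≈-sym (≈-trans (sum-distribʳ (Θ σ₂) (NC l)) (sum-cong (NC l) λ α₁ → sum-distribʳ (Θ σ₂) (NC l))) ⟩
        Θ {l} top * Θ σ₂ ∎
        where
        l : ℕ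
        l = blockSize σ r
        below : ∀ {α β} → Valid α → Valid β → fibre σ α β ≈ when (α ≼ σ) (when (β ≼ σ) (fibre σ α β))
        below {α} {β} vα vβ with ((α ∨ₙ β) ≐ σ) true?
        ... | yes e = let J = join⁻ vα vβ e in
              ≈-sym (≈-trans (when-true (≼⁺ (upperˡ J))) (when-true (≼⁺ (upperʳ J))))
        ... | no ne = ≈-trans (when-false ne) (≈-sym (zeros (α ≼ σ) (β ≼ σ) (when-false ne)))
          where
          zeros : ∀ b b′ {x} → x ≈ 0# → when b (when b′ x) ≈ 0#
          zeros false _ _ = ≈-refl
          zeros true false _ = ≈-refl
          zeros true true e = e
        inner : ∀ {α₁ α₂} → Valid α₁ → Valid α₂ →
          when (α₂ ≼ σ₂) (sum (NC n) λ β → when (β ≼ σ) (fibre σ (glue α₁ α₂) β)) ≈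
          sum (NC l) (λ β₁ → sum (NC n) λ β₂ → fibre top α₁ β₁ * fibre σ₂ α₂ β₂)
        inner {α₁} {α₂} v₁ v₂ = begin
          when (α₂ ≼ σ₂) (sum (NC n) λ β → when (β ≼ σ) (fibre σ (glue α₁ α₂) β))
            ≈⟨ when-congʳ (λ e → sum-glue vσ σr≡r _ (λ vβ vβ′ h → let vg = vglue (≼⁻ v₂ e) in
                 fibre-cong vσ vg vg vβ vβ′ (λ _ → refl) h)) ⟩
          when (α₂ ≼ σ₂) (sum (NC l) λ β₁ → sum (NC n) λ β₂ → when (β₂ ≼ σ₂) (fibre σ (glue α₁ α₂) (glue β₁ β₂)))
            ≈⟨ ≈-trans (when-sum (α₂ ≼ σ₂) (NC l)) (sum-cong (NC l) λ β₁ → when-sum (α₂ ≼ σ₂) (NC n)) ⟩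
          sum (NC l) (λ β₁ → sum (NC n) λ β₂ →
            when (α₂ ≼ σ₂) (when (β₂ ≼ σ₂) (fibre σ (glue α₁ α₂) (glue β₁ β₂))))
            ≈⟨ ΣNC-cong (λ w₁ → ΣNC-cong λ w₂ → fibre-split v₁ v₂ w₁ w₂) ⟩
          sum (NC l) (λ β₁ → sum (NC n) λ β₂ → fibre top α₁ β₁ * fibre σ₂ α₂ β₂) ∎
          where
          vglue : α₂ ⊑ σ₂ → Valid (glue α₁ α₂)
          vglue p = split-valid (glue-⊑-split p) v₁ v₂ p

    -- The only pair whose join is `bot` is `bot` with itself.
    Θ-bot : {σ : Partition n} → Valid σ → σ ≗ bot → Θ σ ≈ 1#
    Θ-bot {n} {σ} vσ σ≗bot = begin
      sum (NC n) (λ α → sum (NC n) (fibre σ α))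
        ≈⟨ NC-single bot-valid _
             (λ vα e → ΣNC-cong λ vβ → fibre-cong vσ vα bot-valid vβ vβ e λ _ → refl)
             (λ vα ne → ≈-trans (ΣNC-cong λ vβ → when-false λ e →
               ne (⊑-resp (λ _ → refl) σ≗bot (upperˡ (join⁻ vα vβ e)))) (sum-ε (NC n) λ _ → ≈-refl)) ⟩
      sum (NC n) (fibre σ bot)
        ≈⟨ NC-single bot-valid _
             (λ vβ e → fibre-cong vσ bot-valid bot-valid vβ bot-valid (λ _ → refl) e)
             (λ vβ ne → when-false λ e →
               ne (⊑-resp (λ _ → refl) σ≗bot (upperʳ (join⁻ bot-valid vβ e)))) ⟩
      fibre σ bot bot
        ≈⟨ when-true (join⁺ bot-valid bot-valid vσ (record
             { upperˡ = bot-⊑ σ ; upperʳ = bot-⊑ σ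
             ; minimal = λ {γ} _ _ _ → ⊑-resp (λ i → sym (σ≗bot i)) (λ _ → refl) (bot-⊑ γ) })) ⟩
      W bot bot σ
        ≈⟨ W-cong (λ _ → refl) (λ _ → refl) σ≗bot ⟩
      W bot bot bot
        ≈⟨ W-bot ⟩
      1# ∎

    -- Induction on the blocks still to be split off. Exploded points become block minima that are
    -- not on the list, so the list is not tied to `blockMins σ`: each point is fixed or has its
    -- minimum on the list.
    Θ-Π : (rs : List (Fin n)) {σ : Partition n} → Valid σ → AllPairs _≢_ rs → (∀ {m} → m ∈ rs → σ m ≡ m) →
      (∀ i → σ i ≡ i ⊎ σ i ∈ rs) → Θ σ ≈ Π rs (λ r → Θ {blockSize σ r} top)
    Θ-Π [] {σ} vσ _ _ cover = Θ-bot vσ λ i → trivial (cover i)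
      where
      trivial : ∀ {i} → σ i ≡ i ⊎ σ i ∈ [] → σ i ≡ i
      trivial (inj₁ e) = e
    Θ-Π (r ∷ rs) {σ} vσ (r≢ ∷ distinct) mins cover = ≈-trans (Θ-split vσ (mins (here refl))) (*-congˡ
      (≈-trans
        (Θ-Π rs M.σ₂-valid distinct (λ m∈ → M.explode-min (mins (there m∈)) (≢r m∈)) (λ i → cover₂ (M.view i)))
        (Π-cong rs λ m∈ → reflexive (cong (λ l → Θ {l} top) (M.explode-size (mins (there m∈)) (≢r m∈))))))
      where
      module M = Block vσ (mins (here refl))
      ≢r : ∀ {m} → m ∈ rs → m ≢ r
      ≢r m∈ e = All.lookup r≢ m∈ (sym e)
      cover₂ : ∀ {i} → M.View i → M.σ₂ i ≡ i ⊎ M.σ₂ i ∈ rs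
      cover₂ (M.inn x) = inj₁ (M.Split.fixed M.σ-split x)
      cover₂ {i} (M.out ne) with cover i
      ... | inj₁ e = inj₁ (trans (sym (M.Split.off M.σ-split ne)) e)
      ... | inj₂ (here e) = contradiction (==⁺ e) ne
      ... | inj₂ (there m∈) = inj₂ (subst (_∈ rs) (M.Split.off M.σ-split ne) m∈)

    Θ-blocks : {σ : Partition n} → Valid σ → Θ σ ≈ Π (blockMins σ) (λ r → Θ {blockSize σ r} top)
    Θ-blocks {n} {σ} vσ = Θ-Π (blockMins σ) vσ
      (AllPairs.map (λ i<j e → ℕₚ.<⇒≢ i<j (cong toℕ e))
        (AllPairsₚ.filter⁺ (Boolₚ.T? ∘ isBlockMin) (allFin-sorted n)))
      (λ m∈ → ==⁻ (proj₂ (∈-filterᵇ⁻ isBlockMin (allFin n) m∈)))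
      (λ i → inj₂ (∈-filterᵇ⁺ isBlockMin (∈ₚ.∈-allFin (σ i)) (==⁺ (idem vσ i))))
      where
      isBlockMin : Fin n → Bool
      isBlockMin i = σ i == i

    -- Each pair lies in just one fibre, that of its join, so summing the fibres over all `σ`
    -- recovers the full sum.
    moment-cumulant : ∀ n → Σ₂ n (λ α β → W α β (α ∨ₙ β)) ≈ 𝓕 (λ k → Θ {k} top) n
    moment-cumulant n = begin
      sum (NC n) (λ α → sum (NC n) λ β → W α β (α ∨ₙ β))
        ≈⟨ Σ₂-cong (λ vα vβ → ≈-sym (by-join vα vβ)) ⟩
      sum (NC n) (λ α → sum (NC n) λ β → sum (NC n) λ σ → fibre σ α β)
        ≈⟨ sum-cong (NC n) (λ α → sum-swap (NC n) (NC n) _) ⟩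
      sum (NC n) (λ α → sum (NC n) λ σ → sum (NC n) λ β → fibre σ α β)
        ≈⟨ sum-swap (NC n) (NC n) _ ⟩
      sum (NC n) Θ
        ≈⟨ ΣNC-cong {n = n} (λ vσ → Θ-blocks vσ) ⟩
      𝓕 (λ k → Θ {k} top) n ∎
      where
      by-join : ∀ {α β} → Valid α → Valid β → sum (NC n) (λ σ → fibre σ α β) ≈ W α β (α ∨ₙ β)
      by-join {α} {β} vα vβ = ≈-trans
        (NC-single (join-valid vα vβ) (λ σ → fibre σ α β)
          (λ {σ} _ e → ≈-trans (≈-trans (when-true (≐⁺ {p = α ∨ₙ β} {σ} λ i → sym (e i)))
                            (W-cong (λ _ → refl) (λ _ → refl) e)) (≈-sym (when-true (≐-refl (α ∨ₙ β)))))
          (λ {σ} _ ne → when-false λ e → ne λ i → sym (≐⁻ {p = α ∨ₙ β} {σ} e i)))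
        (when-true (≐-refl (α ∨ₙ β)))

  𝓕-cong : {κ κ′ : ℕ → Carrier} → (∀ k → κ k ≈ κ′ k) → ∀ n → 𝓕 κ n ≈ 𝓕 κ′ n
  𝓕-cong h n = sum-cong (NC n) λ σ → Π-cong (blockMins σ) λ {r} _ → h (blockSize σ r)

  -- The two weights of the theorem

  module _ (Y A B : Carrier) where
    monomial : ℕ → ℕ → ℕ → Carrier
    monomial x y z = pow Y x * pow A y * pow B z

    monomial-cong : ∀ {x x′ y y′ z z′} → x ≡ x′ → y ≡ y′ → z ≡ z′ → monomial x y z ≈ monomial x′ y′ z′
    monomial-cong refl refl refl = ≈-refl

    monomial-1 : monomial 0 0 0 ≈ 1#
    monomial-1 = ≈-trans (*-identityʳ (1# * 1#)) (*-identityˡ 1#)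

    monomial-+ : ∀ x y z x′ y′ z′ → monomial (x + x′) (y + y′) (z + z′) ≈ monomial x y z * monomial x′ y′ z′
    monomial-+ x y z x′ y′ z′ = ≈-trans
      (*-cong (≈-trans (*-cong (pow-+ Y x x′) (pow-+ A y y′)) (interchange _ _ _ _)) (pow-+ B z z′))
      (interchange _ _ _ _)

    norm-bot : ∥ bot {n} ∥ₚ ≡ 0
    norm-bot {n} = trans (cong (n ∸_) (trans (cycles-perm (bot-valid {n})) all-minimal)) (ℕₚ.n∸n≡0 n)
      where
      all-minimal : blocks (bot {n}) ≡ n
      all-minimal = trans (countF-sum (λ i → bot {n} i == i)) (trans
        (Count.sum-cong (allFin n) (λ i → if-true {x = 1} {0} (==⁺ {i = i} refl)))
        (trans (sym (length-sum (allFin n))) (Listₚ.length-tabulate id)))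

    dist-bot : dist (bot {n}) bot ≡ 0
    dist-bot {n} = trans (cong (n ∸_) (cycles-cong {σ = inv (perm bot) · perm bot} {perm bot} λ i →
        -- For `bot`, preserving blocks means fixing every point, so `perm-same` says that
        -- `perm bot` is the identity.
        trans (inv-inverseˡ (perm-inj (bot-valid {n})) i) (sym (perm-same bot-valid i))))
      (norm-bot {n})

    joinWeight : Weight
    joinWeight = record
      { W = λ α β σ → monomial (dist α β) (dist α σ) (dist β σ)
      ; W-cong = λ hα hβ hσ → monomial-cong (dist-cong hα hβ) (dist-cong hα hσ) (dist-cong hβ hσ)
      ; W-bot = λ {n} → ≈-trans (monomial-cong (dist-bot {n}) (dist-bot {n}) (dist-bot {n})) monomial-1
      ; W-split = split }
      where
      split : {σ : Partition n} (vσ : Valid σ) {r : Fin n} (σr≡r : σ r ≡ r) → let open Block vσ σr≡r in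
        ∀ {α α₁ α₂ β β₁ β₂} → Valid α → Valid α₁ → Valid α₂ → Valid β → Valid β₁ → Valid β₂ →
        Split α α₁ α₂ → Split β β₁ β₂ → monomial (dist α β) (dist α σ) (dist β σ) ≈
        monomial (dist α₁ β₁) (dist α₁ top) (dist β₁ top) * monomial (dist α₂ β₂) (dist α₂ σ₂) (dist β₂ σ₂)
      split {σ = σ} vσ σr≡r {α} {α₁} {α₂} {β} {β₁} {β₂} vα vα₁ vα₂ vβ vβ₁ vβ₂ s t = ≈-trans
        (monomial-cong (dist-split vα vα₁ vα₂ vβ vβ₁ vβ₂ s t)
          (dist-split vα vα₁ vα₂ vσ top-valid σ₂-valid s σ-split)
          (dist-split vβ vβ₁ vβ₂ vσ top-valid σ₂-valid t σ-split))
        (monomial-+ (dist α₁ β₁) (dist α₁ top) (dist β₁ top) (dist α₂ β₂) (dist α₂ σ₂) (dist β₂ σ₂))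
        where open Block vσ σr≡r

    meetTerm : Partition n → Partition n → Carrier
    meetTerm α β = when ((α ∧ₙ β) ≐ bot) (monomial (dist α β) ∥ α ∥ₚ ∥ β ∥ₚ)

    meetTerm-cong : {α α′ β β′ : Partition n} → α ≗ α′ → β ≗ β′ → meetTerm α β ≈ meetTerm α′ β′
    meetTerm-cong {α = α} {α′} {β} {β′} hα hβ = when-cong
      {(α ∧ₙ β) ≐ bot} {(α′ ∧ₙ β′) ≐ bot} (transfer hα hβ) (transfer (λ i → sym (hα i)) (λ i → sym (hβ i)))
      (λ _ → monomial-cong (dist-cong hα hβ) (norm-cong hα) (norm-cong hβ))
      where
      transfer : {α α′ β β′ : Partition _} → α ≗ α′ → β ≗ β′ → (α ∧ₙ β) ≐ bot ≡ true → (α′ ∧ₙ β′) ≐ bot ≡ true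
      transfer {α} {α′} {β} {β′} hα hβ e = meet-bot⁺ {α = α′} {β′} λ p q → meet-bot⁻ {α = α} {β} e
        (trans (hα _) (trans p (sym (hα _)))) (trans (hβ _) (trans q (sym (hβ _))))

    -- Having meet `bot` can be tested on the parts of a split separately, because no common block
    -- of two points crosses the boundary of `C`.
    meetWeight : Weight
    meetWeight = record
      { W = λ α β _ → meetTerm α β
      ; W-cong = λ hα hβ _ → meetTerm-cong hα hβ
      ; W-bot = λ {n} → ≈-trans (when-true (meet-bot⁺ {α = bot {n}} {bot} λ e _ → e))
          (≈-trans (monomial-cong (dist-bot {n}) (norm-bot {n}) (norm-bot {n})) monomial-1)
      ; W-split = split }
      where
      split : {σ : Partition n} (vσ : Valid σ) {r : Fin n} (σr≡r : σ r ≡ r) → let open Block vσ σr≡r in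
        ∀ {α α₁ α₂ β β₁ β₂} → Valid α → Valid α₁ → Valid α₂ → Valid β → Valid β₁ → Valid β₂ →
        Split α α₁ α₂ → Split β β₁ β₂ → meetTerm α β ≈ meetTerm α₁ β₁ * meetTerm α₂ β₂
      split vσ σr≡r {α} {α₁} {α₂} {β} {β₁} {β₂} vα vα₁ vα₂ vβ vβ₁ vβ₂ s t = ≈-trans
        (when-cong {(α ∧ₙ β) ≐ bot} {((α₁ ∧ₙ β₁) ≐ bot) ∧ ((α₂ ∧ₙ β₂) ≐ bot)}
          (λ e → let e₁ , e₂ = separates-split⁻ s t (meet-bot⁻ {α = α} {β} e) in
            ∧⁺ (meet-bot⁺ {α = α₁} {β₁} e₁) (meet-bot⁺ {α = α₂} {β₂} e₂))
          (λ e → let e₁ , e₂ = ∧⁻ {(α₁ ∧ₙ β₁) ≐ bot} e in meet-bot⁺ {α = α} {β}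
            (separates-split⁺ s t (meet-bot⁻ {α = α₁} {β₁} e₁) (meet-bot⁻ {α = α₂} {β₂} e₂)))
          (λ _ → ≈-trans
            (monomial-cong (dist-split vα vα₁ vα₂ vβ vβ₁ vβ₂ s t)
              (norm-split (perm-split vα vα₁ vα₂ s)) (norm-split (perm-split vβ vβ₁ vβ₂ t)))
            (monomial-+ (dist α₁ β₁) ∥ α₁ ∥ₚ ∥ β₁ ∥ₚ (dist α₂ β₂) ∥ α₂ ∥ₚ ∥ β₂ ∥ₚ)))
        (when-* ((α₁ ∧ₙ β₁) ≐ bot) ((α₂ ∧ₙ β₂) ≐ bot))
        where open Block vσ σr≡r

    Θ-join : ∀ k → Θ joinWeight {k} top ≈ fₙ Y A B k
    Θ-join k = Σ₂-cong {n = k} λ {α} {β} vα vβ → when-congʳ {(α ∨ₙ β) ≐ top} λ _ →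
      monomial-cong (refl {x = dist α β}) (dist-top vα) (dist-top vβ)

    Θ-meet : ∀ k → Θ meetWeight {k} top ≈ eₙ Y A B k
    Θ-meet k = Σ₂-cong {n = k} λ {α} {β} _ _ → swap ((α ∨ₙ β) ≐ top) ((α ∧ₙ β) ≐ bot)
      where
      swap : ∀ b b′ {x} → when b (when b′ x) ≈ when (b′ ∧ b) x
      swap false false = ≈-refl
      swap false true = ≈-refl
      swap true false = ≈-refl
      swap true true = ≈-refl

    -- The complement turns the summand of `fₙ` into `meetTerm`; being a bijection of the
    -- non-crossing partitions, it is then removed from the sum over `β` and from the sum over `α`.
    f-kreweras : ∀ n → fₙ Y A B n ≈ Σ₂ n meetTerm
    f-kreweras n = begin
      fₙ Y A B n
        ≈⟨ Σ₂-cong (λ vα vβ → complement vα vβ) ⟩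
      sum (NC n) (λ α → sum (NC n) λ β → meetTerm (kreweras α) (kreweras β))
        ≈⟨ sum-cong (NC n) (λ α → reindex (meetTerm (kreweras α)) λ h → meetTerm-cong (λ _ → refl) h) ⟩
      sum (NC n) (λ α → sum (NC n) (meetTerm (kreweras α)))
        ≈⟨ reindex (λ α → sum (NC n) (meetTerm α)) (λ h → sum-cong (NC n) λ β → meetTerm-cong h λ _ → refl) ⟩
      Σ₂ n meetTerm ∎
      where
      reindex : (h : Partition n → Carrier) → (∀ {p q} → p ≗ q → h p ≈ h q) →
        sum (NC n) (h ∘ kreweras) ≈ sum (NC n) h
      reindex h = NC-reindex kreweras kreweras⁻¹ h (λ {p} _ → kreweras-valid p) (λ {p} _ → kreweras⁻¹-valid p)
        (λ {p} {q} → kreweras-cong {α = p} {q}) (λ {p} {q} → kreweras⁻¹-cong {α = p} {q})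
        kreweras-inverseʳ kreweras-inverseˡ
      complement : ∀ {α β : Partition n} → Valid α → Valid β →
        when ((α ∨ₙ β) ≐ top) (monomial (dist α β) (n ∸ 1 ∸ ∥ α ∥ₚ) (n ∸ 1 ∸ ∥ β ∥ₚ)) ≈
        meetTerm (kreweras α) (kreweras β)
      complement {α} {β} vα vβ = when-cong {(α ∨ₙ β) ≐ top} {(kreweras α ∧ₙ kreweras β) ≐ bot}
        (λ e → ≐⁺ {p = kreweras α ∧ₙ kreweras β} {bot} (join-top⇒meet-bot vα vβ (join⁻ vα vβ e)))
        (λ e → join⁺ vα vβ top-valid (meet-bot⇒join-top vα vβ (≐⁻ {p = kreweras α ∧ₙ kreweras β} {bot} e)))
        (λ _ → monomial-cong (sym (dist-kreweras vα vβ)) (sym (norm-kreweras vα)) (sym (norm-kreweras vβ)))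

    f≈𝓕e : ∀ n → fₙ Y A B n ≈ 𝓕 (eₙ Y A B) n
    f≈𝓕e n = ≈-trans (f-kreweras n) (≈-trans (moment-cumulant meetWeight n) (𝓕-cong Θ-meet n))

    g≈𝓕f : ∀ n → gₙ Y A B n ≈ 𝓕 (fₙ Y A B) n
    g≈𝓕f n = ≈-trans (moment-cumulant joinWeight n) (𝓕-cong Θ-join n)

theorem5p1 : ∀ {c ℓ} (R : CommutativeRing c ℓ) (Y A B : CommutativeRing.Carrier R) (n : ℕ) → 1 ≤ n →
    CommutativeRing._≈_ R (Poly.fₙ R Y A B n) (Poly.𝓕 R (Poly.eₙ R Y A B) n)
    × CommutativeRing._≈_ R (Poly.gₙ R Y A B n) (Poly.𝓕 R (Poly.fₙ R Y A B) n)
theorem5p1 R Y A B n _ = f≈𝓕e Y A B n , g≈𝓕f Y A B n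
  where open Cumulants R
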